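{- Let $q$ be a prime. For any $j\in\mathbb{F}_q^{*}$ and any positive integer $N\le q$, let $T_{2,2}(N;j,q)$ denote the number of quadruples $(b_1,b_2,b_3,b_4)\in\mathbb{F}_q^4$ such that $$b_1+b_2=b_3+b_4 \quad\text{and}\quad b_i^2\in\{j,2j,\ldots,Nj\}\subseteq \mathbb{F}_q,\qquad i=1,2,3,4.$$ Then $$ T_{2,2}(N;j,q)\ll \left(\frac{N^{3/2}}{q^{1/2}}+1\right)N^{2+o(1)}. $$
   Context: $\mathbb{F}_q$ is the field of $q$ elements, $q$ prime; integers are viewed in $\mathbb{F}_q$ by reduction modulo $q$, so $\{j,2j,\ldots,Nj\}$ is a subset of $\mathbb{F}_q$. $U\ll V$ means $|U|\le cV$ for some absolute positive constant $c$. For a quantity $V>1$, $V^{o(1)}$ (as $V\to\infty$) denotes a function $U$ of $V$ satisfying $|U|\le V^{\varepsilon}$ for every $\varepsilon>0$, provided $V$ is large enough in terms of $\varepsilon$; thus the bound means that for every $\varepsilon>0$ there is a constant $C(\varepsilon)$ such that the inequality holds with $C(\varepsilon)N^{2+\varepsilon}$ in place of $N^{2+o(1)}$, uniformly over $q,j,N$. -}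

module Defs where

open import Data.Nat.Base as ℕ using (ℕ; suc)
open import Data.Nat.DivMod using (_mod_)
open import Data.Integer.Base as ℤ using (+_)
open import Data.Rational.Unnormalised.Base as ℚᵘ
  using (ℚᵘ; NonNegative; _/_; ↥_; ↧ₙ_; +-*-rawSemiring)
open import Algebra.Definitions.RawSemiring +-*-rawSemiring using (_^_)
open import Data.Fin.Base using (Fin; toℕ)
open import Data.Fin.Properties using (_≟_)
open import Data.List.Base using (List; length; filter; allFin; applyUpTo; cartesianProduct)
open import Data.Product.Base using (_×_; _,_)
open import Relation.Binary.PropositionalEquality using (_≡_)
open import Relation.Nullary.Decidable using (_×-dec_)
open import Relation.Unary using (Decidable)
import Data.List.Membership.DecPropositional as DecMembership

-- The residue ring ℤ/q on representatives 0 … q-1; it is the field 𝔽_q when q is prime.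
module Residues (q : ℕ) .{{_ : ℕ.NonZero q}} where

  infixl 6 _⊕_
  infixl 7 _⊗_

  𝔽 : Set
  𝔽 = Fin q

  ⟦_⟧ : ℕ → 𝔽
  ⟦ n ⟧ = n mod q

  _⊕_ _⊗_ : 𝔽 → 𝔽 → 𝔽
  a ⊕ b = ⟦ toℕ a ℕ.+ toℕ b ⟧
  a ⊗ b = ⟦ toℕ a ℕ.* toℕ b ⟧

  open DecMembership (_≟_ {q}) using (_∈_; _∈?_)

  -- j, 2j, …, Nj
  multiples : 𝔽 → ℕ → List 𝔽
  multiples j N = applyUpTo (λ n → ⟦ suc n ⟧ ⊗ j) N

  Quadruple : Set
  Quadruple = 𝔽 × 𝔽 × 𝔽 × 𝔽

  quadruples : List Quadruple
  quadruples = cartesianProduct 𝔽s (cartesianProduct 𝔽s (cartesianProduct 𝔽s 𝔽s))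
    where
    𝔽s : List 𝔽
    𝔽s = allFin q

  Counted : 𝔽 → ℕ → Quadruple → Set
  Counted j N (b₁ , b₂ , b₃ , b₄) =
    b₁ ⊕ b₂ ≡ b₃ ⊕ b₄ ×
    b₁ ⊗ b₁ ∈ multiples j N ×
    b₂ ⊗ b₂ ∈ multiples j N ×
    b₃ ⊗ b₃ ∈ multiples j N ×
    b₄ ⊗ b₄ ∈ multiples j N

  counted? : ∀ j N → Decidable (Counted j N)
  counted? j N (b₁ , b₂ , b₃ , b₄) =
    (b₁ ⊕ b₂ ≟ b₃ ⊕ b₄) ×-dec
    ((b₁ ⊗ b₁ ∈? multiples j N) ×-dec
    ((b₂ ⊗ b₂ ∈? multiples j N) ×-dec
    ((b₃ ⊗ b₃ ∈? multiples j N) ×-dec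
     (b₄ ⊗ b₄ ∈? multiples j N))))

  T₂₂ : 𝔽 → ℕ → ℕ
  T₂₂ j N = length (filter (counted? j N) quadruples)

fromℕ : ℕ → ℚᵘ
fromℕ n = + n / 1

-- The real number x^e, for x : ℕ and a rational exponent e ≥ 0, is given by its
-- Dedekind cut: for rational r ≥ 0, comparing r with x^(a/b) means comparing r^b
-- with x^a.  A real inequality t ≤ f(α, β, γ) whose right-hand side is continuous,
-- increasing in α and γ and decreasing in β > 0, is then the statement that
-- t ≤ f(u, v, w) for all rational u ≥ α, 0 < v ≤ β, w ≥ γ.
-- (The exponents used are non-negative, so ∣ ↥ e ∣ is just their numerator.)

infix 4 [_^_]≤_ _≤[_^_]

[_^_]≤_ : ℕ → ℚᵘ → ℚᵘ → Set
[ x ^ e ]≤ u = NonNegative u × fromℕ x ^ ℤ.∣ ↥ e ∣ ℚᵘ.≤ u ^ ↧ₙ e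

_≤[_^_] : ℚᵘ → ℕ → ℚᵘ → Set
v ≤[ x ^ e ] = NonNegative v × v ^ ↧ₙ e ℚᵘ.≤ fromℕ x ^ ℤ.∣ ↥ e ∣

{-# OPTIONS --safe #-}
module Submission where

-- Group the quadruples by h = b₁ - b₃ = b₄ - b₂, so that T₂₂ = Σ_h r(h)², where r(h) counts
-- the b with b² = n j and (b + h)² = m j, 1 ≤ m, n ≤ N.  With k = m - n and s = m + n one has
-- j k = h (2b + h), so k determines b, and for two such b the vector (x, y) = (k² - k′², s - s′)
-- lies in the lattice j x ≡ 2h² y (mod q), in a box of size N² × 2N.  Up to divisor functions,
-- r(h)² is at most the number of these lattice vectors.  If they are not all collinear, there
-- are O(N³/q) of them, hence r(h)² ≤ N^o(1) (N³/q + 1); these h contribute at most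
-- max r(h) · Σ_h r(h), and Σ_h r(h) = O(N²).
--
-- Otherwise all of them are multiples t (x₀, y₀) of a primitive vector.  Since x₀ divides
-- k² - k′² = (k - k′)(k + k′), once r(h) exceeds the number of divisors of x₀ the pigeonhole
-- principle writes x₀ = ± u v with u and v dividing a common l ≤ 2N, which leaves N^(1+o(1))
-- values of x₀.  The remaining quadruples are determined by y = t y₀, its divisor t, x₀, the
-- divisor k - k′ of t x₀ and the choice of a square root h: N^(2+o(1)) possibilities.

open import Defs
open import Data.Bool.Base using (Bool; true; false; if_then_else_)
open import Data.Empty using (⊥; ⊥-elim)
open import Data.Nat.Base as ℕ using (ℕ; zero; suc; z≤n; s≤s; z<s; s<s; NonZero; ≢-nonZero; ≢-nonZero⁻¹; >-nonZero)
import Data.Nat.Properties as ℕ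
import Data.Nat.Divisibility as ℕ
open import Data.Nat.ListAction using (product)
open import Data.Nat.ListAction.Properties using (∈⇒∣product; product≢0)
open import Data.Nat.Primality using (Prime; _Rough_; euclidsLemma; prime⇒nonZero; prime⇒nonTrivial; prime⇒irreducible; rough∧∣⇒prime; rough∧∣⇒rough; ∤⇒rough-suc; 2-rough; rough⇒≤)
open import Data.Nat.Primality.Factorisation using (PrimeFactorisation; factorise)
open import Data.Nat.Tactic.RingSolver using () renaming (solve-∀ to solve-∀ℕ)
open import Data.Fin.Base as Fin using (Fin; toℕ)
open import Data.Fin.Properties as Fin using (injective⇒≤; pigeonhole; toℕ-fromℕ<; toℕ-injective; toℕ<n)
open import Data.List.Base using (List; []; _∷_; _++_; length; lookup; map; filter; take; upTo; applyUpTo; concatMap; allFin; cartesianProduct)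
open import Data.List.Properties using (length-++; length-map; length-upTo; length-take; take-all)
open import Data.List.Extrema ℕ.≤-totalOrder using (argmin; argmin-all; f[argmin]≤f[⊤]; f[argmin]≤f[xs])
open import Data.List.Membership.Propositional using (_∈_)
open import Data.List.Membership.Propositional.Properties using (∈-lookup; ∈-map⁺; ∈-map⁻; ∈-++⁺ˡ; ∈-++⁺ʳ; ∈-++⁻; ∈-concatMap⁺; ∈-upTo⁺; ∈-upTo⁻; ∈-filter⁺; ∈-filter⁻; ∈-applyUpTo⁺; ∈-applyUpTo⁻; ∈-cartesianProduct⁺; ∈-cartesianProduct⁻; ∈-allFin)
import Data.List.Membership.DecPropositional as DecMembership
open import Data.List.Relation.Unary.All as All using (All; []; _∷_)
open import Data.List.Relation.Unary.AllPairs using ([]; _∷_)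
open import Data.List.Relation.Unary.Any as Any using (here; there)
open import Data.List.Relation.Unary.Any.Properties using (lookup-index)
open import Data.List.Relation.Unary.Unique.Propositional using (Unique)
import Data.List.Relation.Unary.Unique.Propositional.Properties as Unique
open import Data.Product.Base using (∃-syntax; _×_; _,_; proj₁; proj₂)
open import Data.Sum.Base as Sum using (_⊎_; inj₁; inj₂; [_,_]′)
open import Function.Base using (_∘_)
open import Relation.Binary.Definitions using (tri<; tri≈; tri>)
open import Relation.Binary.PropositionalEquality using (_≡_; _≢_; refl; sym; trans; cong; cong₂; subst; subst₂; module ≡-Reasoning)
open import Relation.Nullary using (¬_; Dec; yes; no; contradiction; ¬?; _×-dec_)
open import Relation.Nullary.Decidable using (dec-true; dec-false; does)
open import Relation.Unary using (Decidable)

-- A lattice with one very short vector may put about N of its multiples into the box, so for such h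
-- the lattice gives no usable bound on r(h). These h can only be controlled together. That works
-- because the relation j x ≡ 2h² y returns h up to sign from a single vector with y not divisible
-- by q: it is enough to list the vectors that can occur for any h at all, and for this x₀ must come
-- from a list independent of h.
--
-- The line between the two kinds of h is an integer B, the largest with B² q ≤ (17 D)² (N³ + q),
-- where D bounds the divisor function up to 8N³. This range covers 2N, N² and 2N², the sizes of the
-- integers whose divisors are listed. The condition 8N < q turns congruences between numbers of
-- size O(N) into equalities; for q ≤ 8N the trivial r(h) ≤ 4N already gives r(h) ≤ B. Degenerate
-- configurations, h = 0 and k′ = ± k, carry no lattice information and are counted directly, at a
-- cost of O(N²).

module Counting where

  -- Upper bounds for cardinalities by injective codes

  open import Data.Nat.Base using (_+_; _*_; _≤_)
  open import Data.Nat.Properties using (+-mono-≤; +-suc; module ≤-Reasoning)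

  -- Quantifying over duplicate-free lists gives a cardinality bound for predicates with existential
  -- content, without deciding or enumerating them.
  AtMost : ∀ {A : Set} → ℕ → (A → Set) → Set
  AtMost M P = ∀ xs → Unique xs → All P xs → length xs ≤ M

  lookup-injective : ∀ {A : Set} {xs : List A} → Unique xs →
                     ∀ {i j} → lookup xs i ≡ lookup xs j → i ≡ j
  lookup-injective (_ ∷ _) {Fin.zero} {Fin.zero} _ = refl
  lookup-injective {xs = _ ∷ xs} (x∉ ∷ _) {Fin.zero} {Fin.suc j} eq =
    contradiction eq (All.lookup x∉ (∈-lookup {xs = xs} j))
  lookup-injective {xs = _ ∷ xs} (x∉ ∷ _) {Fin.suc i} {Fin.zero} eq =
    contradiction (sym eq) (All.lookup x∉ (∈-lookup {xs = xs} i))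
  lookup-injective (_ ∷ u) {Fin.suc i} {Fin.suc j} eq = cong Fin.suc (lookup-injective u eq)

  -- Codes are attached by a relation, so that a code may leave some data of the element
  -- existential; it only has to determine the element.
  Coded : ∀ {A C : Set} → (A → C → Set) → List C → A → Set
  Coded R cs x = ∃[ c ] c ∈ cs × R x c

  module _ {A C : Set} {R : A → C → Set} where

    -- Sending a position of `xs` to the position of its code in `cs` is injective: equal positions
    -- hold equal codes, these have equal elements, and `xs` has no repetitions.
    atMost-coded : (∀ x y c → R x c → R y c → x ≡ y) →
                   ∀ cs → AtMost (length cs) (Coded R cs)
    atMost-coded inj cs xs u ps = injective⇒≤ {f = λ i → Any.index (mem i)}
      (λ {i} {j} eq → lookup-injective u (inj _ _ _ (rel i) (subst (R _) (codes≡ j i (sym eq)) (rel j))))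
      where
      coded : ∀ i → Coded R cs (lookup xs i)
      coded i = All.lookup ps (∈-lookup {xs = xs} i)
      mem : ∀ i → proj₁ (coded i) ∈ cs
      mem i = proj₁ (proj₂ (coded i))
      rel : ∀ i → R (lookup xs i) (proj₁ (coded i))
      rel i = proj₂ (proj₂ (coded i))
      codes≡ : ∀ i j → Any.index (mem i) ≡ Any.index (mem j) → proj₁ (coded i) ≡ proj₁ (coded j)
      codes≡ i j eq = trans (lookup-index (mem i)) (trans (cong (lookup cs) eq) (sym (lookup-index (mem j))))

  module _ {A : Set} {P Q : A → Set} where

    atMost-⊆ : ∀ {M} → (∀ {x} → P x → Q x) → AtMost M Q → AtMost M P
    atMost-⊆ P⊆Q bound xs u ps = bound xs u (All.map P⊆Q ps)

    atMost-∪ : ∀ {M M′} → AtMost M P → AtMost M′ Q → AtMost (M + M′) (λ x → P x ⊎ Q x)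
    atMost-∪ {M} {M′} boundP boundQ xs u ps =
      let ys , zs , len , uy , uz , py , qz , _ = split xs u ps in
      subst (_≤ M + M′) (sym len) (+-mono-≤ (boundP ys uy py) (boundQ zs uz qz))
      where
      -- The last component is there for the induction: with `S` the predicate of differing from
      -- `x`, it keeps both halves duplicate-free.
      split : ∀ xs → Unique xs → All (λ x → P x ⊎ Q x) xs →
              ∃[ ys ] ∃[ zs ] length xs ≡ length ys + length zs × Unique ys × Unique zs ×
              All P ys × All Q zs × (∀ {S : A → Set} → All S xs → All S ys × All S zs)
      split [] u [] = [] , [] , refl , [] , [] , [] , [] , λ _ → [] , []
      split (x ∷ xs) (x∉ ∷ u) (p ∷ ps) with split xs u ps
      ... | ys , zs , len , uy , uz , py , qz , sub with p
      ...   | inj₁ px = x ∷ ys , zs , cong suc len , proj₁ (sub x∉) ∷ uy , uz , px ∷ py , qz ,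
                        λ { (s ∷ ss) → s ∷ proj₁ (sub ss) , proj₂ (sub ss) }
      ...   | inj₂ qx = ys , x ∷ zs , trans (cong suc len) (sym (+-suc _ _)) , uy , proj₂ (sub x∉) ∷ uz , py , qx ∷ qz ,
                        λ { (s ∷ ss) → proj₁ (sub ss) , s ∷ proj₂ (sub ss) }

  module _ {A B : Set} where

    pairs : List A → (A → List B) → List (A × B)
    pairs xs f = concatMap (λ x → map (x ,_) (f x)) xs

    ∈-pairs : ∀ {xs f x y} → x ∈ xs → y ∈ f x → (x , y) ∈ pairs xs f
    ∈-pairs {xs} {f} {x} x∈ y∈ =
      ∈-concatMap⁺ _ (Any.map (λ { refl → ∈-map⁺ (x ,_) y∈ }) x∈)

    length-pairs : ∀ {M} xs {f} → (∀ {x} → x ∈ xs → length (f x) ≤ M) → length (pairs xs f) ≤ length xs * M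
    length-pairs [] _ = z≤n
    length-pairs {M} (x ∷ xs) {f} bound = begin
      length (map (x ,_) (f x) ++ pairs xs f)         ≡⟨ length-++ (map (x ,_) (f x)) ⟩
      length (map (x ,_) (f x)) + length (pairs xs f) ≡⟨ cong (_+ length (pairs xs f)) (length-map (x ,_) (f x)) ⟩
      length (f x) + length (pairs xs f)              ≤⟨ +-mono-≤ (bound (here refl)) (length-pairs xs (bound ∘ there)) ⟩
      M + length xs * M                               ∎
      where open ≤-Reasoning

-- The divisor bound τ(n)^k ≤ C(k) n

module Divisors where

  open import Data.Nat.Base
  open import Data.Nat.Coprimality using (coprime-divisor)
  open import Data.Nat.Divisibility
  open import Data.Nat.DivMod using (_/_; _%_; m≡m%n+[m/n]*n; m%n<n)
  open import Data.Nat.Induction using (<-rec)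
  open import Data.Nat.Properties
  open Counting

  divisors : ℕ → List ℕ
  divisors n = filter (_∣? n) (applyUpTo suc n)

  τ : ℕ → ℕ
  τ n = length (divisors n)

  ∈-divisors : ∀ {d n} .{{_ : NonZero n}} → d ∣ n → d ∈ divisors n
  ∈-divisors {zero} {n} d∣n = contradiction (0∣⇒≡0 d∣n) (≢-nonZero⁻¹ n)
  ∈-divisors {suc d} {n} d∣n = ∈-filter⁺ (_∣? n) (∈-applyUpTo⁺ suc (∣⇒≤ d∣n)) d∣n

  τ≤ : ∀ {n M} → AtMost M (_∣ n) → τ n ≤ M
  τ≤ {n} bound = bound (divisors n)
    (Unique.filter⁺ (_∣? n) (Unique.applyUpTo⁺₁ suc n (λ i<j _ → <⇒≢ (s<s i<j))))
    (All.tabulate (proj₂ ∘ ∈-filter⁻ (_∣? n) {xs = applyUpTo suc n}))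

  prime∤⇒∣ : ∀ {p d n} → Prime p → ¬ (p ∣ d) → d ∣ p * n → d ∣ n
  prime∤⇒∣ {p} {d} pp p∤d = coprime-divisor λ { {i} (i∣d , i∣p) →
    [ (λ i≡1 → i≡1) , (λ { refl → contradiction i∣d p∤d }) ]′ (prime⇒irreducible pp i∣p) }

  divisor-of-p^e*m : ∀ {p} → Prime p → ∀ e {m d} → d ∣ p ^ e * m →
                     ∃[ i ] ∃[ d′ ] i < suc e × d′ ∣ m × d ≡ p ^ i * d′
  divisor-of-p^e*m pp zero {m} {d} d∣ = 0 , d , z<s , subst (d ∣_) (*-identityˡ m) d∣ , sym (*-identityˡ d)
  divisor-of-p^e*m {p} pp (suc e) {m} {d} d∣ with p ∣? d
  ... | yes (divides c refl) =
    let i , d′ , i<e , d′∣m , eq = divisor-of-p^e*m pp e {m} {c} (*-cancelˡ-∣ p (subst₂ _∣_ (*-comm c p) (*-assoc p (p ^ e) m) d∣))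
    in suc i , d′ , s<s i<e , d′∣m , (begin-equality
      c * p              ≡⟨ *-comm c p ⟩
      p * c              ≡⟨ cong (p *_) eq ⟩
      p * (p ^ i * d′)   ≡⟨ *-assoc p (p ^ i) d′ ⟨
      p ^ suc i * d′     ∎)
    where
    open ≤-Reasoning
    instance _ = prime⇒nonZero pp
  ... | no p∤d =
    let i , d′ , i<e , rest = divisor-of-p^e*m pp e (prime∤⇒∣ pp p∤d (subst (d ∣_) (*-assoc p (p ^ e) m) d∣))
    in i , d′ , m<n⇒m<1+n i<e , rest

  τ[p^e*m]≤ : ∀ {p} → Prime p → ∀ e m .{{_ : NonZero m}} → τ (p ^ e * m) ≤ suc e * τ m
  τ[p^e*m]≤ {p} pp e m = τ≤ {p ^ e * m} (λ xs u ds → ≤-trans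
    (atMost-coded {R = λ d c → d ≡ p ^ proj₁ c * proj₂ c} (λ { _ _ _ refl refl → refl }) codes xs u
      (All.map (λ d∣ → let i , d′ , i<e , d′∣m , eq = divisor-of-p^e*m pp e d∣
                       in (i , d′) , ∈-pairs (∈-upTo⁺ i<e) (∈-divisors d′∣m) , eq) ds))
    (subst (λ l → length codes ≤ l * τ m) (length-upTo (suc e)) (length-pairs (upTo (suc e)) {λ _ → divisors m} (λ _ → ≤-refl))))
    where
    codes : List (ℕ × ℕ)
    codes = pairs (upTo (suc e)) (λ _ → divisors m)

  ^-*-distrib : ∀ m n k → (m * n) ^ k ≡ m ^ k * n ^ k
  ^-*-distrib m n zero = refl
  ^-*-distrib m n (suc k) = trans (cong (m * n *_) (^-*-distrib m n k)) ([m*n]*[o*p]≡[m*o]*[n*p] m n (m ^ k) (n ^ k))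

  1+n≤2^n : ∀ n → suc n ≤ 2 ^ n
  1+n≤2^n zero = ≤-refl
  1+n≤2^n (suc n) = begin
    suc (suc n)       ≤⟨ s≤s (1+n≤2^n n) ⟩
    1 + 2 ^ n         ≤⟨ +-monoˡ-≤ (2 ^ n) (m^n>0 2 n) ⟩
    2 ^ n + 2 ^ n     ≡⟨ cong (2 ^ n +_) (+-identityʳ (2 ^ n)) ⟨
    2 ^ suc n         ∎
    where open ≤-Reasoning

  -- Writing e = r + a k with r < k gives e + 1 ≤ k (a + 1) ≤ k 2^a.
  [1+e]^k≤k^k*2^e : ∀ k .{{_ : NonZero k}} e → suc e ^ k ≤ k ^ k * 2 ^ e
  [1+e]^k≤k^k*2^e k e = begin
    suc e ^ k              ≤⟨ ^-monoˡ-≤ k 1+e≤ ⟩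
    (k * 2 ^ a) ^ k        ≡⟨ ^-*-distrib k (2 ^ a) k ⟩
    k ^ k * (2 ^ a) ^ k    ≡⟨ cong (k ^ k *_) (^-*-assoc 2 a k) ⟩
    k ^ k * 2 ^ (a * k)    ≤⟨ *-monoʳ-≤ (k ^ k) (^-monoʳ-≤ 2 (subst (a * k ≤_) (sym e≡) (m≤n+m (a * k) (e % k)))) ⟩
    k ^ k * 2 ^ e          ∎
    where
    open ≤-Reasoning
    a = e / k
    e≡ : e ≡ e % k + a * k
    e≡ = m≡m%n+[m/n]*n e k
    1+e≤ : suc e ≤ k * 2 ^ a
    1+e≤ = begin
      suc e               ≡⟨ cong suc e≡ ⟩
      suc (e % k) + a * k ≤⟨ +-monoˡ-≤ (a * k) (m%n<n e k) ⟩
      suc a * k           ≡⟨ *-comm (suc a) k ⟩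
      k * suc a           ≤⟨ *-monoʳ-≤ k (1+n≤2^n a) ⟩
      k * 2 ^ a           ∎

  remove-factor : ∀ p .{{_ : NonTrivial p}} n .{{_ : NonZero n}} → ∃[ e ] ∃[ m ] n ≡ p ^ e * m × ¬ (p ∣ m)
  remove-factor p {{p>1}} n {{n≢0}} = <-rec (λ n → .(NonZero n) → ∃[ e ] ∃[ m ] n ≡ p ^ e * m × ¬ (p ∣ m)) step n n≢0
    where
    step : ∀ n → (∀ {m} → m < n → .(NonZero m) → ∃[ e ] ∃[ m′ ] m ≡ p ^ e * m′ × ¬ (p ∣ m′)) →
           .(NonZero n) → ∃[ e ] ∃[ m ] n ≡ p ^ e * m × ¬ (p ∣ m)
    step n rec n≢0 with p ∣? n
    ... | no p∤n = 0 , n , sym (*-identityˡ n) , p∤n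
    ... | yes p∣n =
      let e , m , eq , p∤m = rec (quotient-< p∣n {{p>1}} {{n≢0}}) (quotient≢0 p∣n {{n≢0}}) in
      suc e , m , trans (m∣n⇒n≡m*quotient p∣n) (trans (cong (p *_) eq) (sym (*-assoc p (p ^ e) m))) , p∤m

  module _ (k : ℕ) .{{_ : NonZero k}} where

    open ≤-Reasoning

    -- Each prime, counted with multiplicity, at most doubles τ, and p ≥ 2^k pays for the factor
    -- 2^k.
    τ^k≤-largePrimes : ∀ ps → All Prime ps → All (2 ^ k ≤_) ps → τ (product ps) ^ k ≤ product ps
    τ^k≤-largePrimes [] [] [] = ≤-reflexive (^-zeroˡ k)
    τ^k≤-largePrimes (p ∷ ps) (pp ∷ pps) (large ∷ larges) = begin
      τ (p * n) ^ k        ≤⟨ ^-monoˡ-≤ k (subst (λ z → τ (z * n) ≤ 2 * τ n) (*-identityʳ p) (τ[p^e*m]≤ pp 1 n)) ⟩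
      (2 * τ n) ^ k        ≡⟨ ^-*-distrib 2 (τ n) k ⟩
      2 ^ k * τ n ^ k      ≤⟨ *-mono-≤ large (τ^k≤-largePrimes ps pps larges) ⟩
      p * n                ∎
      where
      n = product ps
      instance _ = product≢0 (All.map prime⇒nonZero pps)

    -- B runs through the candidates for small primes, with i of them left. If B divides the B-rough
    -- n it is prime, and its full power B^e is split off at the cost (e + 1)^k ≤ k^k 2^e ≤ k^k B^e:
    -- a factor k^k whatever e is. From 2^k on only large primes remain.
    τ^k≤-rough : ∀ i B .{{_ : NonTrivial B}} → 2 ^ k ≤ B + i → ∀ n .{{_ : NonZero n}} → B Rough n →
                 τ n ^ k ≤ (k ^ k) ^ i * n
    τ^k≤-rough zero B 2^k≤B n rough = begin
      τ n ^ k             ≡⟨ cong (λ m → τ m ^ k) isFactorisation ⟩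
      τ (product factors) ^ k ≤⟨ τ^k≤-largePrimes factors factorsPrime (All.tabulate large) ⟩
      product factors     ≡⟨ isFactorisation ⟨
      n                   ≡⟨ *-identityˡ n ⟨
      1 * n               ∎
      where
      open PrimeFactorisation (factorise n)
      large : ∀ {p} → p ∈ factors → 2 ^ k ≤ p
      large {p} p∈ = ≤-trans (≤-trans 2^k≤B (≤-reflexive (+-identityʳ B)))
        (rough⇒≤ (rough∧∣⇒rough rough (subst (p ∣_) (sym isFactorisation) (∈⇒∣product p∈))))
        where instance _ = prime⇒nonTrivial (All.lookup factorsPrime p∈)
    τ^k≤-rough (suc i) B 2^k≤B n rough with B ∣? n
    ... | no B∤n = ≤-trans
      (τ^k≤-rough i (suc B) {{nonTrivial-suc}} (subst (2 ^ k ≤_) (+-suc B i) 2^k≤B) n (∤⇒rough-suc B∤n rough))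
      (*-monoˡ-≤ n (m≤n*m ((k ^ k) ^ i) (k ^ k)))
      where
      instance _ = m^n≢0 k k
      nonTrivial-suc : NonTrivial (suc B)
      nonTrivial-suc = n>1⇒nonTrivial (m<n⇒m<1+n (nonTrivial⇒n>1 B))
    ... | yes B∣n with remove-factor B n
    ...   | e , m , refl , B∤m = begin
      τ (B ^ e * m) ^ k                 ≤⟨ ^-monoˡ-≤ k (τ[p^e*m]≤ (rough∧∣⇒prime rough B∣n) e m) ⟩
      (suc e * τ m) ^ k                 ≡⟨ ^-*-distrib (suc e) (τ m) k ⟩
      suc e ^ k * τ m ^ k               ≤⟨ *-mono-≤ ([1+e]^k≤k^k*2^e k e)
                                             (τ^k≤-rough i (suc B) {{nonTrivial-suc}} (subst (2 ^ k ≤_) (+-suc B i) 2^k≤B) m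
                                               (∤⇒rough-suc B∤m (rough∧∣⇒rough rough (n∣m*n (B ^ e))))) ⟩
      (K * 2 ^ e) * (K ^ i * m)         ≤⟨ *-monoˡ-≤ (K ^ i * m) (*-monoʳ-≤ K (^-monoˡ-≤ e (nonTrivial⇒n>1 B))) ⟩
      (K * B ^ e) * (K ^ i * m)         ≡⟨ [m*n]*[o*p]≡[m*o]*[n*p] K (B ^ e) (K ^ i) m ⟩
      K ^ suc i * (B ^ e * m)           ∎
      where
      K = k ^ k
      instance
        _ = m*n≢0⇒n≢0 (B ^ e) {m}
      nonTrivial-suc : NonTrivial (suc B)
      nonTrivial-suc = n>1⇒nonTrivial (m<n⇒m<1+n (nonTrivial⇒n>1 B))

    τ^k≤ : ∃[ C ] NonZero C × (∀ n .{{_ : NonZero n}} → τ n ^ k ≤ C * n)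
    -- Every n is 2-rough, so the descent starts at B = 2, with 2^k steps of cost k^k each.
    τ^k≤ = (k ^ k) ^ (2 ^ k) , m^n≢0 (k ^ k) (2 ^ k) {{m^n≢0 k k}} ,
           λ n → τ^k≤-rough (2 ^ k) 2 (m≤n+m (2 ^ k) 2) n 2-rough

  -- The place where the maximum is attained is kept, so that the divisor bound can be applied there
  -- to bound D itself.
  τ-max : ∀ n → ∃[ D ] (∀ {m} → m ≤ n → τ m ≤ D) × ∃[ m ] m ≤ n × D ≡ τ m
  τ-max zero = τ 0 , (λ { z≤n → ≤-refl }) , 0 , z≤n , refl
  τ-max (suc n) with τ-max n
  ... | D , bound , m , m≤n , D≡ with ≤-total D (τ (suc n))
  ...   | inj₁ D≤ = τ (suc n) , (λ m≤ → [ (λ { (s≤s m≤n) → ≤-trans (bound m≤n) D≤ }) , (λ { refl → ≤-refl }) ]′ (m≤n⇒m<n∨m≡n m≤)) , suc n , ≤-refl , refl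
  ...   | inj₂ ≤D = D , (λ m≤ → [ (λ { (s≤s m≤n) → bound m≤n }) , (λ { refl → ≤D }) ]′ (m≤n⇒m<n∨m≡n m≤)) , m , m≤n⇒m≤1+n m≤n , D≡

  -- An integer square root of Z / q; searching up to Z suffices since r ≤ r² q.
  largest-square : ∀ q .{{_ : NonZero q}} Z → ∃[ B ] B * B * q ≤ Z × (∀ r → r * r * q ≤ Z → r ≤ B)
  largest-square q Z = let B , B≤ , max = search Z in
    B , B≤ , λ r r≤ → max r (≤-trans (≤-trans (r≤r² r) (m≤m*n (r * r) q)) r≤) r≤
    where
    r≤r² : ∀ r → r ≤ r * r
    r≤r² zero = z≤n
    r≤r² (suc r) = m≤m*n (suc r) (suc r)
    search : ∀ n → ∃[ B ] B * B * q ≤ Z × (∀ r → r ≤ n → r * r * q ≤ Z → r ≤ B)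
    search zero = 0 , z≤n , λ r r≤0 _ → r≤0
    search (suc n) with suc n * suc n * q ≤? Z | search n
    ... | yes ok | _ = suc n , ok , λ r r≤ _ → r≤
    ... | no ¬ok | B , B≤ , max = B , B≤ , λ r r≤ ok →
      [ (λ r<1+n → max r (s≤s⁻¹ r<1+n) ok) , (λ { refl → contradiction ok ¬ok }) ]′ (m≤n⇒m<n∨m≡n r≤)

  ^-cancelˡ-≤ : ∀ k .{{_ : NonZero k}} {m n} → m ^ k ≤ n ^ k → m ≤ n
  ^-cancelˡ-≤ k m^k≤n^k = ≮⇒≥ λ n<m → <⇒≱ (^-monoˡ-< k n<m) m^k≤n^k

  m≤m^k : ∀ m k .{{_ : NonZero m}} .{{_ : NonZero k}} → m ≤ m ^ k
  m≤m^k m (suc k) = m≤m*n m (m ^ k) {{m^n≢0 m k}}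

  -- D is the maximum of τ on [0, 8N³]; the divisor bound with exponent k = 12 b makes D^(4b) linear in N.
  divisor-constant : ∀ b .{{_ : NonZero b}} → ∃[ C ] NonZero C × (∀ N .{{_ : NonZero N}} →
    ∃[ D ] (∀ {n} → n ≤ 8 * (N * N * N) → τ n ≤ D) ×
           (∀ a → (N * N * (D * D * (D * D))) ^ b ≤ C ^ b * N ^ (2 * b + suc a)))
  divisor-constant b with τ^k≤ (4 * b * 3) {{m*n≢0 (4 * b) 3 {{m*n≢0 4 b}}}}
  ... | C₀ , C₀≢0 , τ-bound = C , C≢0 , λ N → let D , τ≤D , m , m≤ , D≡ = τ-max (8 * (N * N * N)) in
    D , τ≤D , bound N D (D^≤ N m m≤ D≡)
    where
    open ≤-Reasoning
    C : ℕ
    C = 8 * C₀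
    instance
      C≢0 : NonZero C
      C≢0 = m*n≢0 8 C₀ {{_}} {{C₀≢0}}
    k : ℕ
    k = 4 * b * 3
    τ^≤ : ∀ m → τ m ^ k ≤ C₀ * m
    τ^≤ zero = subst (_≤ C₀ * 0) (sym (0^k k {{m*n≢0 (4 * b) 3 {{m*n≢0 4 b}}}})) z≤n
      where
      0^k : ∀ k .{{_ : NonZero k}} → 0 ^ k ≡ 0
      0^k (suc k) = refl
    τ^≤ (suc m) = τ-bound (suc m)
    D^≤ : ∀ N .{{_ : NonZero N}} {D} m → m ≤ 8 * (N * N * N) → D ≡ τ m → D ^ (4 * b) ≤ C * N
    D^≤ N m m≤ refl = ^-cancelˡ-≤ 3 (begin
      (τ m ^ (4 * b)) ^ 3        ≡⟨ ^-*-assoc (τ m) (4 * b) 3 ⟩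
      τ m ^ k                    ≤⟨ τ^≤ m ⟩
      C₀ * m                     ≤⟨ *-monoʳ-≤ C₀ m≤ ⟩
      C₀ * (8 * (N * N * N))     ≡⟨ id₁ C₀ N ⟩
      C * (N * N * N)            ≤⟨ *-monoˡ-≤ (N * N * N) (m≤m^k C 3) ⟩
      C ^ 3 * (N * N * N)        ≡⟨ cong (C ^ 3 *_) (id₂ N) ⟩
      C ^ 3 * N ^ 3              ≡⟨ ^-*-distrib C N 3 ⟨
      (C * N) ^ 3                ∎)
      where
      id₁ : ∀ c N → c * (8 * (N * N * N)) ≡ 8 * c * (N * N * N)
      id₁ = solve-∀ℕ
      id₂ : ∀ N → N * N * N ≡ N * (N * (N * 1))
      id₂ = solve-∀ℕ
    bound : ∀ N .{{_ : NonZero N}} D → D ^ (4 * b) ≤ C * N → ∀ a → (N * N * (D * D * (D * D))) ^ b ≤ C ^ b * N ^ (2 * b + suc a)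
    bound N D D^≤ a = begin
      (N * N * (D * D * (D * D))) ^ b  ≡⟨ cong (_^ b) (id₁ N D) ⟩
      (N ^ 2 * D ^ 4) ^ b              ≡⟨ ^-*-distrib (N ^ 2) (D ^ 4) b ⟩
      (N ^ 2) ^ b * (D ^ 4) ^ b        ≡⟨ cong₂ _*_ (^-*-assoc N 2 b) (^-*-assoc D 4 b) ⟩
      N ^ (2 * b) * D ^ (4 * b)        ≤⟨ *-monoʳ-≤ (N ^ (2 * b)) D^≤ ⟩
      N ^ (2 * b) * (C * N)            ≤⟨ *-monoʳ-≤ (N ^ (2 * b)) (*-mono-≤ (m≤m^k C b) (m≤m^k N (suc a))) ⟩
      N ^ (2 * b) * (C ^ b * N ^ suc a) ≡⟨ id₂ (N ^ (2 * b)) (C ^ b) (N ^ suc a) ⟩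
      C ^ b * (N ^ (2 * b) * N ^ suc a) ≡⟨ cong (C ^ b *_) (^-distribˡ-+-* N (2 * b) (suc a)) ⟨
      C ^ b * N ^ (2 * b + suc a)      ∎
      where
      id₁ : ∀ N D → N * N * (D * D * (D * D)) ≡ N * (N * 1) * (D * (D * (D * (D * 1))))
      id₁ = solve-∀ℕ
      id₂ : ∀ x y z → x * (y * z) ≡ y * (x * z)
      id₂ = solve-∀ℕ

-- Integers of bounded size, signed divisors, congruences modulo a prime

module Energies where

  open import Data.Nat.Coprimality using (Coprime; coprime-divisor; gcd≡1⇒coprime)
  open import Data.Nat.DivMod using (_/_; _%_; m≡m%n+[m/n]*n; m%n<n; m<n⇒m%n≡m; m/n*n≤m; m≥n⇒m/n>0; /-monoˡ-≤; m*n/n≡m)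
  open import Data.Nat.GCD using (gcd; gcd[m,n]∣m; gcd[m,n]∣n; gcd-greatest; c*gcd[m,n]≡gcd[cm,cn])
  open import Data.Integer.Base as ℤ using (ℤ; +_; -[1+_]; _+_; _*_; _-_; -_; ∣_∣; 0ℤ)
  open import Data.Integer.Divisibility.Signed using (_∣_; divides; ∣ᵤ⇒∣; ∣⇒∣ᵤ; _∣?_; ∣m∣n⇒∣m+n; ∣m∣n⇒∣m-n; ∣n⇒∣m*n; ∣m⇒∣m*n; ∣m⇒∣-m)
  open import Data.Integer.Properties as ℤ using (abs-*; ∣i+j∣≤∣i∣+∣j∣; ∣i-j∣≤∣i∣+∣j∣; ∣i∣≡0⇒i≡0; ∣-i∣≡∣i∣; ∣m⊝n∣≤m⊔n; m-n≡m⊖n; ⊖-≥; pos-*; pos-+)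
  open import Data.Integer.Tactic.RingSolver using (solve-∀)
  open Counting
  open Divisors

  range : ℕ → List ℤ
  range M = map +_ (upTo (suc M)) ++ map -[1+_] (upTo M)

  ∈-range⁺ : ∀ {M} z → ∣ z ∣ ℕ.≤ M → z ∈ range M
  ∈-range⁺ (+ n) n≤M = ∈-++⁺ˡ (∈-map⁺ +_ (∈-upTo⁺ (s≤s n≤M)))
  ∈-range⁺ {M} -[1+ n ] n<M = ∈-++⁺ʳ (map +_ (upTo (suc M))) (∈-map⁺ -[1+_] (∈-upTo⁺ n<M))

  ∈-range⁻ : ∀ {M z} → z ∈ range M → ∣ z ∣ ℕ.≤ M
  ∈-range⁻ {M} z∈ with ∈-++⁻ (map +_ (upTo (suc M))) z∈
  ... | inj₁ z∈⁺ with n , n∈ , refl ← ∈-map⁻ +_ z∈⁺ = ℕ.s≤s⁻¹ (∈-upTo⁻ n∈)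
  ... | inj₂ z∈⁻ with n , n∈ , refl ← ∈-map⁻ -[1+_] z∈⁻ = ∈-upTo⁻ n∈

  length-range : ∀ M → length (range M) ≡ suc M ℕ.+ M
  length-range M = trans (length-++ (map +_ (upTo (suc M))))
    (cong₂ ℕ._+_ (trans (length-map +_ (upTo (suc M))) (length-upTo (suc M)))
                 (trans (length-map -[1+_] (upTo M)) (length-upTo M)))

  range-unique : ∀ M → Unique (range M)
  range-unique M = Unique.++⁺ (Unique.map⁺ (λ { refl → refl }) (Unique.upTo⁺ (suc M)))
    (Unique.map⁺ (λ { refl → refl }) (Unique.upTo⁺ M))
    λ { (z∈⁺ , z∈⁻) → disjoint (∈-map⁻ +_ z∈⁺) (∈-map⁻ -[1+_] z∈⁻) }
    where
    disjoint : ∀ {z xs ys} → ∃[ n ] n ∈ xs × z ≡ + n → ∃[ n ] n ∈ ys × z ≡ -[1+ n ] → ⊥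
    disjoint (_ , _ , refl) (_ , _ , ())

  signed : List ℕ → List ℤ
  signed ns = map +_ ns ++ map (λ n → - + n) ns

  ∈-signed : ∀ {ns} z → ∣ z ∣ ∈ ns → z ∈ signed ns
  ∈-signed (+ n) n∈ = ∈-++⁺ˡ (∈-map⁺ +_ n∈)
  ∈-signed {ns} -[1+ n ] n∈ = ∈-++⁺ʳ (map +_ ns) (∈-map⁺ (λ n → - + n) n∈)

  length-signed : ∀ ns → length (signed ns) ≡ 2 ℕ.* length ns
  length-signed ns = trans (length-++ (map +_ ns))
    (cong₂ ℕ._+_ (length-map +_ ns) (trans (length-map _ ns) (sym (ℕ.+-identityʳ (length ns)))))

  signedDivisors : ℤ → List ℤ
  signedDivisors z = signed (divisors ∣ z ∣)

  ∈-signedDivisors : ∀ {d z} → z ≢ 0ℤ → d ∣ z → d ∈ signedDivisors z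
  ∈-signedDivisors {d} {z} z≢0 d∣z = ∈-signed d (∈-divisors (∣⇒∣ᵤ d∣z))
    where instance _ = ≢-nonZero (z≢0 ∘ ∣i∣≡0⇒i≡0)

  sgn : ℤ → ℤ
  sgn (+ _) = + 1
  sgn -[1+ _ ] = ℤ.-1ℤ

  sgn-*-self : ∀ z → sgn z * z ≡ + ∣ z ∣
  sgn-*-self (+ n) = ℤ.*-identityˡ (+ n)
  sgn-*-self -[1+ n ] = ℤ.-1*i≡-i -[1+ n ]

  ∣sgn*∣ : ∀ z w → ∣ sgn z * w ∣ ≡ ∣ w ∣
  ∣sgn*∣ (+ n) w = cong ∣_∣ (ℤ.*-identityˡ w)
  ∣sgn*∣ -[1+ n ] w = trans (cong ∣_∣ (ℤ.-1*i≡-i w)) (∣-i∣≡∣i∣ w)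

  shift-nonNeg : ∀ z {M} → ∣ z ∣ ℕ.≤ M → ∃[ g ] z + + M ≡ + g × g ℕ.≤ M ℕ.+ M
  shift-nonNeg (+ n) {M} n≤M = n ℕ.+ M , refl , ℕ.+-monoˡ-≤ M n≤M
  shift-nonNeg -[1+ n ] {M} n<M = M ℕ.∸ suc n , ⊖-≥ n<M , ℕ.≤-trans (ℕ.m∸n≤m M (suc n)) (ℕ.m≤m+n M M)

  ∣r-r′∣< : ∀ {r r′ ν} → r ℕ.< ν → r′ ℕ.< ν → ∣ + r - + r′ ∣ ℕ.< ν
  ∣r-r′∣< {r} {r′} r<ν r′<ν = ℕ.≤-<-trans (subst (λ z → ∣ z ∣ ℕ.≤ r ℕ.⊔ r′) (sym (m-n≡m⊖n r r′)) (∣m⊝n∣≤m⊔n r r′)) (ℕ.⊔-pres-<m r<ν r′<ν)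

  ∣z⇒≡0 : ∀ {q z} → + q ∣ z → ∣ z ∣ ℕ.< q → z ≡ 0ℤ
  ∣z⇒≡0 {q} {z} q∣z z<q with ∣ z ∣ in eq | ∣⇒∣ᵤ q∣z
  ... | zero | _ = ∣i∣≡0⇒i≡0 eq
  ... | suc n | q∣n = contradiction q∣n (ℕ.>⇒∤ z<q)

  prime∣* : ∀ {q} → Prime q → ∀ a b → + q ∣ a * b → (+ q ∣ a) ⊎ (+ q ∣ b)
  prime∣* {q} pq a b q∣ab = Sum.map ∣ᵤ⇒∣ ∣ᵤ⇒∣
    (euclidsLemma ∣ a ∣ ∣ b ∣ pq (subst (q ℕ.∣_) (abs-* a b) (∣⇒∣ᵤ q∣ab)))

  prime∣*-cancelˡ : ∀ {q} → Prime q → ∀ a b → ¬ (+ q ∣ a) → + q ∣ a * b → + q ∣ b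
  prime∣*-cancelˡ pq a b q∤a q∣ab = [ (λ q∣a → contradiction q∣a q∤a) , (λ q∣b → q∣b) ]′ (prime∣* pq a b q∣ab)

  -- Points of the lattice α x ≡ γ y (mod q) in a box

  module Lattice {q : ℕ} (pq : Prime q) (α γ : ℤ) (q∤α : ¬ (+ q ∣ α)) (q∤γ : ¬ (+ q ∣ γ))
                 (N : ℕ) .{{_ : NonZero N}} (8N<q : 8 ℕ.* N ℕ.< q) where

    infix 4 _∈L
    _∈L : ℤ × ℤ → Set
    (x , y) ∈L = + q ∣ α * x - γ * y

    -- The lattice contains (q, 0), which lies in the box as soon as q ≤ N². Excluding y = 0 removes
    -- these vectors; pairs with s = s′ are treated separately.
    InBox : ℕ → ℕ → ℤ × ℤ → Set
    InBox X Y (x , y) = (x , y) ∈L × y ≢ 0ℤ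

    inBox? : ∀ X Y → Decidable (InBox X Y)
    inBox? X Y (x , y) = (+ q ∣? (α * x - γ * y)) ×-dec ¬? (y ℤ.≟ 0ℤ)

    box : ℕ → ℕ → List (ℤ × ℤ)
    box X Y = filter (inBox? X Y) (cartesianProduct (range X) (range Y))

    ∈-box⁺ : ∀ {X Y x y} → ∣ x ∣ ℕ.≤ X → ∣ y ∣ ℕ.≤ Y → (x , y) ∈L → y ≢ 0ℤ → (x , y) ∈ box X Y
    ∈-box⁺ {X} {Y} {x} {y} x≤ y≤ l y≢0 = ∈-filter⁺ (inBox? X Y) (∈-cartesianProduct⁺ (∈-range⁺ x x≤) (∈-range⁺ y y≤)) (l , y≢0)

    ∈-box⁻ : ∀ {X Y x y} → (x , y) ∈ box X Y → ∣ x ∣ ℕ.≤ X × ∣ y ∣ ℕ.≤ Y × (x , y) ∈L × y ≢ 0ℤ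
    ∈-box⁻ {X} {Y} p∈ =
      let p∈× , l , y≢0 = ∈-filter⁻ (inBox? X Y) {xs = cartesianProduct (range X) (range Y)} p∈
          x∈ , y∈ = ∈-cartesianProduct⁻ (range X) (range Y) p∈×
      in ∈-range⁻ x∈ , ∈-range⁻ y∈ , l , y≢0

    box-unique : ∀ X Y → Unique (box X Y)
    box-unique X Y = Unique.filter⁺ (inBox? X Y) (Unique.cartesianProduct⁺ (range-unique X) (range-unique Y))

    S : List (ℤ × ℤ)
    S = box (N ℕ.* N) (2 ℕ.* N)

    -- The weight N on y balances the two sides of a box of size N² × 2N.
    ν : ℤ × ℤ → ℕ
    ν (x , y) = ∣ x ∣ ℕ.+ N ℕ.* ∣ y ∣

    -- Minimality is asked for in the doubled box 2N² × 4N because it is applied to differences of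
    -- two points of the box N² × 2N.
    module Shortest {x₀ y₀ : ℤ} (v₀∈L : (x₀ , y₀) ∈L) (y₀≢0 : y₀ ≢ 0ℤ)
                    (x₀≤ : ∣ x₀ ∣ ℕ.≤ 2 ℕ.* (N ℕ.* N)) (y₀≤ : ∣ y₀ ∣ ℕ.≤ 4 ℕ.* N)
                    (shortest : ∀ {x y} → ∣ x ∣ ℕ.≤ 2 ℕ.* (N ℕ.* N) → ∣ y ∣ ℕ.≤ 4 ℕ.* N →
                                (x , y) ∈L → y ≢ 0ℤ → ν (x₀ , y₀) ℕ.≤ ν (x , y)) where

      ν₀ : ℕ
      ν₀ = ν (x₀ , y₀)

      instance
        ∣y₀∣-nonZero : NonZero ∣ y₀ ∣
        ∣y₀∣-nonZero = ≢-nonZero (y₀≢0 ∘ ∣i∣≡0⇒i≡0)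
        y₀-nonZero : ℤ.NonZero y₀
        y₀-nonZero = ℤ.≢-nonZero y₀≢0

      ν₀>0 : 0 ℕ.< ν₀
      ν₀>0 = ℕ.<-≤-trans (ℕ.>-nonZero⁻¹ (N ℕ.* ∣ y₀ ∣) {{ℕ.m*n≢0 N ∣ y₀ ∣}}) (ℕ.m≤n+m _ ∣ x₀ ∣)

      instance
        ν₀-nonZero : NonZero ν₀
        ν₀-nonZero = >-nonZero ν₀>0

      det : ℤ × ℤ → ℤ
      det (x , y) = x₀ * y - y₀ * x

      -- Modulo q the lattice is a line, so any two of its vectors are dependent there.
      ∣-det : ∀ {x y} → (x , y) ∈L → + q ∣ det (x , y)
      ∣-det {x} {y} l = prime∣*-cancelˡ pq α (det (x , y)) q∤α
        (subst (+ q ∣_) (sym (identity α γ x₀ y₀ x y))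
          (∣m∣n⇒∣m-n (∣n⇒∣m*n y v₀∈L) (∣n⇒∣m*n y₀ l)))
        where
        identity : ∀ α γ x₀ y₀ x y → α * (x₀ * y - y₀ * x) ≡ y * (α * x₀ - γ * y₀) - y₀ * (α * x - γ * y)
        identity = solve-∀

      ∣det∣≤ : ∀ {x y} → ∣ x ∣ ℕ.≤ N ℕ.* N → ∣ y ∣ ℕ.≤ 2 ℕ.* N → ∣ det (x , y) ∣ ℕ.≤ 2 ℕ.* N ℕ.* ν₀
      ∣det∣≤ {x} {y} x≤ y≤ = begin
        ∣ x₀ * y - y₀ * x ∣                         ≤⟨ ∣i-j∣≤∣i∣+∣j∣ (x₀ * y) (y₀ * x) ⟩
        ∣ x₀ * y ∣ ℕ.+ ∣ y₀ * x ∣                   ≡⟨ cong₂ ℕ._+_ (abs-* x₀ y) (abs-* y₀ x) ⟩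
        a ℕ.* ∣ y ∣ ℕ.+ b ℕ.* ∣ x ∣                 ≤⟨ ℕ.+-mono-≤ (ℕ.*-monoʳ-≤ a y≤) (ℕ.*-monoʳ-≤ b x≤) ⟩
        -- The second term is doubled to complete a multiple of ν₀.
        a ℕ.* (2 ℕ.* N) ℕ.+ b ℕ.* (N ℕ.* N)         ≤⟨ ℕ.m≤m+n _ (b ℕ.* (N ℕ.* N)) ⟩
        a ℕ.* (2 ℕ.* N) ℕ.+ b ℕ.* (N ℕ.* N) ℕ.+ b ℕ.* (N ℕ.* N) ≡⟨ identity a b N ⟩
        2 ℕ.* N ℕ.* ν₀                              ∎
        where
        open ℕ.≤-Reasoning
        a = ∣ x₀ ∣
        b = ∣ y₀ ∣
        identity : ∀ a b N → a ℕ.* (2 ℕ.* N) ℕ.+ b ℕ.* (N ℕ.* N) ℕ.+ b ℕ.* (N ℕ.* N) ≡ 2 ℕ.* N ℕ.* (a ℕ.+ N ℕ.* b)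
        identity = solve-∀ℕ

      -- f (x₀ , y₀) = ν₀, and ∣ f ∣ = ν on the line through (x₀ , y₀): lattice points with the same det whose
      -- values of f fall in a common interval of length ν₀ therefore coincide.
      f : ℤ × ℤ → ℤ
      f (x , y) = sgn x₀ * x + + N * (sgn y₀ * y)

      ∣f∣≤ : ∀ {x y} → ∣ x ∣ ℕ.≤ N ℕ.* N → ∣ y ∣ ℕ.≤ 2 ℕ.* N → ∣ f (x , y) ∣ ℕ.≤ 3 ℕ.* (N ℕ.* N)
      ∣f∣≤ {x} {y} x≤ y≤ = begin
        ∣ sgn x₀ * x + + N * (sgn y₀ * y) ∣         ≤⟨ ∣i+j∣≤∣i∣+∣j∣ (sgn x₀ * x) (+ N * (sgn y₀ * y)) ⟩
        ∣ sgn x₀ * x ∣ ℕ.+ ∣ + N * (sgn y₀ * y) ∣   ≡⟨ cong₂ ℕ._+_ (∣sgn*∣ x₀ x) (trans (abs-* (+ N) (sgn y₀ * y)) (cong (N ℕ.*_) (∣sgn*∣ y₀ y))) ⟩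
        ∣ x ∣ ℕ.+ N ℕ.* ∣ y ∣                       ≤⟨ ℕ.+-mono-≤ x≤ (ℕ.*-monoʳ-≤ N y≤) ⟩
        N ℕ.* N ℕ.+ N ℕ.* (2 ℕ.* N)                 ≡⟨ identity N ⟩
        3 ℕ.* (N ℕ.* N)                             ∎
        where
        open ℕ.≤-Reasoning
        identity : ∀ N → N ℕ.* N ℕ.+ N ℕ.* (2 ℕ.* N) ≡ 3 ℕ.* (N ℕ.* N)
        identity = solve-∀ℕ

      +ν₀≡ : + ν₀ ≡ sgn x₀ * x₀ + + N * (sgn y₀ * y₀)
      +ν₀≡ = trans (pos-+ ∣ x₀ ∣ (N ℕ.* ∣ y₀ ∣))
        (cong₂ _+_ (sym (sgn-*-self x₀)) (trans (pos-* N ∣ y₀ ∣) (cong (+ N *_) (sym (sgn-*-self y₀)))))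

      module _ {x y : ℤ} (parallel : det (x , y) ≡ 0ℤ) where

        -- On the line spanned by (x₀, y₀) the ratio of `f` to ν₀ is the coefficient of that vector;
        -- this identity and `ν₀*y` express it without division.
        ν₀*x : ν₀ ℕ.* ∣ x ∣ ≡ ∣ x₀ ∣ ℕ.* ∣ f (x , y) ∣
        ν₀*x = trans (sym (abs-* (+ ν₀) x)) (trans (cong ∣_∣ eq) (abs-* x₀ (f (x , y))))
          where
          identity : ∀ s t n x₀ y₀ x y → (s * x₀ + n * (t * y₀)) * x + n * t * (x₀ * y - y₀ * x) ≡ x₀ * (s * x + n * (t * y))
          identity = solve-∀
          eq : + ν₀ * x ≡ x₀ * f (x , y)
          eq = begin
            + ν₀ * x                                              ≡⟨ cong (_* x) +ν₀≡ ⟩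
            (sgn x₀ * x₀ + + N * (sgn y₀ * y₀)) * x               ≡⟨ ℤ.+-identityʳ _ ⟨
            (sgn x₀ * x₀ + + N * (sgn y₀ * y₀)) * x + 0ℤ          ≡⟨ cong (_+_ ((sgn x₀ * x₀ + + N * (sgn y₀ * y₀)) * x)) (trans (cong (+ N * sgn y₀ *_) parallel) (ℤ.*-zeroʳ (+ N * sgn y₀))) ⟨
            (sgn x₀ * x₀ + + N * (sgn y₀ * y₀)) * x + + N * sgn y₀ * det (x , y) ≡⟨ identity (sgn x₀) (sgn y₀) (+ N) x₀ y₀ x y ⟩
            x₀ * f (x , y)                                        ∎
            where open ≡-Reasoning

        ν₀*y : ν₀ ℕ.* ∣ y ∣ ≡ ∣ y₀ ∣ ℕ.* ∣ f (x , y) ∣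
        ν₀*y = trans (sym (abs-* (+ ν₀) y)) (trans (cong ∣_∣ eq) (abs-* y₀ (f (x , y))))
          where
          identity : ∀ s t n x₀ y₀ x y → (s * x₀ + n * (t * y₀)) * y - s * (x₀ * y - y₀ * x) ≡ y₀ * (s * x + n * (t * y))
          identity = solve-∀
          eq : + ν₀ * y ≡ y₀ * f (x , y)
          eq = begin
            + ν₀ * y                                              ≡⟨ cong (_* y) +ν₀≡ ⟩
            (sgn x₀ * x₀ + + N * (sgn y₀ * y₀)) * y               ≡⟨ ℤ.+-identityʳ _ ⟨
            (sgn x₀ * x₀ + + N * (sgn y₀ * y₀)) * y - 0ℤ          ≡⟨ cong (λ z → (sgn x₀ * x₀ + + N * (sgn y₀ * y₀)) * y - z) (trans (cong (sgn x₀ *_) parallel) (ℤ.*-zeroʳ (sgn x₀))) ⟨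
            (sgn x₀ * x₀ + + N * (sgn y₀ * y₀)) * y - sgn x₀ * det (x , y) ≡⟨ identity (sgn x₀) (sgn y₀) (+ N) x₀ y₀ x y ⟩
            y₀ * f (x , y)                                        ∎
            where open ≡-Reasoning

        ν≡∣f∣ : ν (x , y) ≡ ∣ f (x , y) ∣
        ν≡∣f∣ = ℕ.*-cancelˡ-≡ _ _ ν₀ (begin
          ν₀ ℕ.* (∣ x ∣ ℕ.+ N ℕ.* ∣ y ∣)              ≡⟨ id₁ ν₀ N ∣ x ∣ ∣ y ∣ ⟩
          ν₀ ℕ.* ∣ x ∣ ℕ.+ N ℕ.* (ν₀ ℕ.* ∣ y ∣)       ≡⟨ cong₂ (λ a b → a ℕ.+ N ℕ.* b) ν₀*x ν₀*y ⟩
          ∣ x₀ ∣ ℕ.* F ℕ.+ N ℕ.* (∣ y₀ ∣ ℕ.* F)       ≡⟨ id₂ F N ∣ x₀ ∣ ∣ y₀ ∣ ⟩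
          ν₀ ℕ.* F                                    ∎)
          where
          open ≡-Reasoning
          F = ∣ f (x , y) ∣
          id₁ : ∀ v n a b → v ℕ.* (a ℕ.+ n ℕ.* b) ≡ v ℕ.* a ℕ.+ n ℕ.* (v ℕ.* b)
          id₁ = solve-∀ℕ
          id₂ : ∀ F n a b → a ℕ.* F ℕ.+ n ℕ.* (b ℕ.* F) ≡ (a ℕ.+ n ℕ.* b) ℕ.* F
          id₂ = solve-∀ℕ

        -- If y ≠ 0, minimality of ν₀ contradicts ν = ∣f∣ < ν₀. If y = 0, a vector parallel to one
        -- with y₀ ≠ 0 has x = 0 too.
        short-parallel≡0 : ∣ x ∣ ℕ.≤ 2 ℕ.* (N ℕ.* N) → ∣ y ∣ ℕ.≤ 4 ℕ.* N → (x , y) ∈L →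
                           ∣ f (x , y) ∣ ℕ.< ν₀ → x ≡ 0ℤ × y ≡ 0ℤ
        short-parallel≡0 x≤ y≤ l f<ν₀ with y ℤ.≟ 0ℤ
        ... | no y≢0 = contradiction (ℕ.≤-trans (shortest x≤ y≤ l y≢0) (ℕ.≤-reflexive ν≡∣f∣)) (ℕ.<⇒≱ f<ν₀)
        ... | yes refl = ∣i∣≡0⇒i≡0 (cancel0 ν₀ (trans ν₀*x (trans (cong (∣ x₀ ∣ ℕ.*_) F≡0) (ℕ.*-zeroʳ ∣ x₀ ∣)))) , refl
          where
          cancel0 : ∀ m {n} .{{_ : NonZero m}} → m ℕ.* n ≡ 0 → n ≡ 0
          cancel0 m {n} eq = ℕ.*-cancelˡ-≡ n 0 m (trans eq (sym (ℕ.*-zeroʳ m)))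
          F≡0 : ∣ f (x , y) ∣ ≡ 0
          F≡0 = cancel0 ∣ y₀ ∣ (trans (sym ν₀*y) (ℕ.*-zeroʳ ν₀))

      SmallVector : ℤ × ℤ → Set
      SmallVector (x , y) = ∣ x ∣ ℕ.≤ N ℕ.* N × ∣ y ∣ ℕ.≤ 2 ℕ.* N × (x , y) ∈L

      -- m numbers the lines parallel to (x₀, y₀) that carry lattice points, and i the interval of
      -- length ν₀ containing `f`, after the shift by 3N² that makes `f` non-negative.
      Code : ℤ × ℤ → ℤ × ℕ → Set
      Code p (m , i) = SmallVector p × det p ≡ m * + q ×
        ∃[ r ] r ℕ.< ν₀ × f p + + (3 ℕ.* (N ℕ.* N)) ≡ + (i ℕ.* ν₀ ℕ.+ r)

      code-injective : ∀ p p′ c → Code p c → Code p′ c → p ≡ p′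
      code-injective (x , y) (x′ , y′) (m , i) ((x≤ , y≤ , l) , det≡ , r , r<ν₀ , f≡) ((x′≤ , y′≤ , l′) , det′≡ , r′ , r′<ν₀ , f′≡) =
        cong₂ _,_ (ℤ.i-j≡0⇒i≡j x x′ (proj₁ w≡0)) (ℤ.i-j≡0⇒i≡j y y′ (proj₂ w≡0))
        where
        parallel : det (x - x′ , y - y′) ≡ 0ℤ
        parallel = trans (identity x₀ y₀ x y x′ y′) (trans (cong₂ _-_ det≡ det′≡) (ℤ.+-inverseʳ (m * + q)))
          where
          identity : ∀ x₀ y₀ x y x′ y′ → x₀ * (y - y′) - y₀ * (x - x′) ≡ (x₀ * y - y₀ * x) - (x₀ * y′ - y₀ * x′)
          identity = solve-∀
        f-w : f (x - x′ , y - y′) ≡ + r - + r′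
        f-w = begin
          f (x - x′ , y - y′)                                        ≡⟨ id₁ (sgn x₀) (sgn y₀) (+ N) x y x′ y′ (+ (3 ℕ.* (N ℕ.* N))) ⟩
          (f (x , y) + + (3 ℕ.* (N ℕ.* N))) - (f (x′ , y′) + + (3 ℕ.* (N ℕ.* N))) ≡⟨ cong₂ _-_ f≡ f′≡ ⟩
          + (i ℕ.* ν₀ ℕ.+ r) - + (i ℕ.* ν₀ ℕ.+ r′)                   ≡⟨ cong₂ _-_ (pos-+ (i ℕ.* ν₀) r) (pos-+ (i ℕ.* ν₀) r′) ⟩
          (+ (i ℕ.* ν₀) + + r) - (+ (i ℕ.* ν₀) + + r′)               ≡⟨ id₂ (+ (i ℕ.* ν₀)) (+ r) (+ r′) ⟩
          + r - + r′                                                 ∎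
          where
          open ≡-Reasoning
          id₁ : ∀ s t n x y x′ y′ c → s * (x - x′) + n * (t * (y - y′)) ≡ (s * x + n * (t * y) + c) - (s * x′ + n * (t * y′) + c)
          id₁ = solve-∀
          id₂ : ∀ c r r′ → (c + r) - (c + r′) ≡ r - r′
          id₂ = solve-∀
        lattice : (x - x′ , y - y′) ∈L
        lattice = subst (+ q ∣_) (identity α γ x y x′ y′) (∣m∣n⇒∣m-n l l′)
          where
          identity : ∀ α γ x y x′ y′ → (α * x - γ * y) - (α * x′ - γ * y′) ≡ α * (x - x′) - γ * (y - y′)
          identity = solve-∀
        double : ∀ {z z′ M} → ∣ z ∣ ℕ.≤ M → ∣ z′ ∣ ℕ.≤ M → ∣ z - z′ ∣ ℕ.≤ 2 ℕ.* M
        double {z} {z′} {M} z≤ z′≤ = ℕ.≤-trans (∣i-j∣≤∣i∣+∣j∣ z z′)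
          (ℕ.+-mono-≤ z≤ (ℕ.≤-trans z′≤ (ℕ.≤-reflexive (sym (ℕ.+-identityʳ M)))))
        w≡0 : x - x′ ≡ 0ℤ × y - y′ ≡ 0ℤ
        w≡0 = short-parallel≡0 parallel (double {x} {x′} x≤ x′≤)
          (subst (∣ y - y′ ∣ ℕ.≤_) (sym (ℕ.*-assoc 2 2 N)) (double {y} {y′} y≤ y′≤)) lattice
          (subst (λ z → ∣ z ∣ ℕ.< ν₀) (sym f-w) (∣r-r′∣< r<ν₀ r′<ν₀))

      instance
        q-nonZero : NonZero q
        q-nonZero = >-nonZero (ℕ.≤-<-trans z≤n 8N<q)

      module _ (q≤2Nν₀ : q ℕ.≤ 2 ℕ.* N ℕ.* ν₀) where

        private
          R I : ℕ
          R = 2 ℕ.* N ℕ.* ν₀ / q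
          I = 6 ℕ.* (N ℕ.* N) / ν₀

          codes : List (ℤ × ℕ)
          codes = pairs (range R) (λ _ → upTo (suc I))

        ∈S⇒coded : ∀ {p} → p ∈ S → Coded Code codes p
        ∈S⇒coded {x , y} p∈ =
          let x≤ , y≤ , l , _ = ∈-box⁻ {N ℕ.* N} {2 ℕ.* N} p∈
              divides m det≡ = ∣-det l
              g , f≡ , g≤ = shift-nonNeg (f (x , y)) (∣f∣≤ x≤ y≤)
              m≤ : ∣ m ∣ ℕ.≤ R
              m≤ = subst (ℕ._≤ R) (m*n/n≡m ∣ m ∣ q) (/-monoˡ-≤ q (subst (ℕ._≤ 2 ℕ.* N ℕ.* ν₀) (trans (cong ∣_∣ det≡) (abs-* m (+ q))) (∣det∣≤ x≤ y≤)))
              g/ν₀≤ : g / ν₀ ℕ.≤ I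
              g/ν₀≤ = /-monoˡ-≤ ν₀ (ℕ.≤-trans g≤ (ℕ.≤-reflexive (sym (ℕ.*-distribʳ-+ (N ℕ.* N) 3 3))))
          in (m , g / ν₀) , ∈-pairs (∈-range⁺ m m≤) (∈-upTo⁺ (s≤s g/ν₀≤)) ,
             (x≤ , y≤ , l) , det≡ , g % ν₀ , m%n<n g ν₀ ,
             trans f≡ (cong +_ (trans (m≡m%n+[m/n]*n g ν₀) (ℕ.+-comm (g % ν₀) _)))

        ∣S∣≤ : length S ℕ.≤ (suc R ℕ.+ R) ℕ.* suc I
        ∣S∣≤ = begin
          length S                    ≤⟨ atMost-coded {R = Code} code-injective codes S (box-unique (N ℕ.* N) (2 ℕ.* N)) (All.tabulate ∈S⇒coded) ⟩
          length codes                ≤⟨ length-pairs (range R) {λ _ → upTo (suc I)} (λ _ → ℕ.≤-reflexive (length-upTo (suc I))) ⟩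
          length (range R) ℕ.* suc I  ≡⟨ cong (ℕ._* suc I) (length-range R) ⟩
          (suc R ℕ.+ R) ℕ.* suc I     ∎
          where open ℕ.≤-Reasoning

        -- (2R + 1)(I + 1) ≤ 3R · 2I because R ≥ 1, by the assumption on q, and I ≥ 1, by ν₀ ≤ 6N².
        -- The length ν₀ then cancels: 6 · 2Nν₀ · 6N² = 72 N³ ν₀.
        ∣S∣*q≤ : length S ℕ.* q ℕ.≤ 72 ℕ.* (N ℕ.* N ℕ.* N)
        ∣S∣*q≤ = ℕ.*-cancelʳ-≤ _ _ ν₀ (begin
          length S ℕ.* q ℕ.* ν₀                      ≤⟨ ℕ.*-monoˡ-≤ ν₀ (ℕ.*-monoˡ-≤ q ∣S∣≤) ⟩
          (suc R ℕ.+ R) ℕ.* suc I ℕ.* q ℕ.* ν₀       ≤⟨ ℕ.*-monoˡ-≤ ν₀ (ℕ.*-monoˡ-≤ q (ℕ.*-mono-≤ (ℕ.+-monoˡ-≤ R (ℕ.+-monoˡ-≤ R R≥1)) (ℕ.+-monoˡ-≤ I I≥1))) ⟩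
          (R ℕ.+ R ℕ.+ R) ℕ.* (I ℕ.+ I) ℕ.* q ℕ.* ν₀ ≡⟨ id₁ R I q ν₀ ⟩
          6 ℕ.* ((R ℕ.* q) ℕ.* (I ℕ.* ν₀))           ≤⟨ ℕ.*-monoʳ-≤ 6 (ℕ.*-mono-≤ (m/n*n≤m (2 ℕ.* N ℕ.* ν₀) q) (m/n*n≤m (6 ℕ.* (N ℕ.* N)) ν₀)) ⟩
          6 ℕ.* ((2 ℕ.* N ℕ.* ν₀) ℕ.* (6 ℕ.* (N ℕ.* N))) ≡⟨ id₂ N ν₀ ⟩
          72 ℕ.* (N ℕ.* N ℕ.* N) ℕ.* ν₀              ∎)
          where
          open ℕ.≤-Reasoning
          R≥1 : 1 ℕ.≤ R
          R≥1 = m≥n⇒m/n>0 q≤2Nν₀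
          I≥1 : 1 ℕ.≤ I
          I≥1 = m≥n⇒m/n>0 (begin
            ∣ x₀ ∣ ℕ.+ N ℕ.* ∣ y₀ ∣                  ≤⟨ ℕ.+-mono-≤ x₀≤ (ℕ.*-monoʳ-≤ N y₀≤) ⟩
            2 ℕ.* (N ℕ.* N) ℕ.+ N ℕ.* (4 ℕ.* N)      ≡⟨ id₃ N ⟩
            6 ℕ.* (N ℕ.* N)                          ∎)
            where
            id₃ : ∀ N → 2 ℕ.* (N ℕ.* N) ℕ.+ N ℕ.* (4 ℕ.* N) ≡ 6 ℕ.* (N ℕ.* N)
            id₃ = solve-∀ℕ
          id₁ : ∀ R I q ν₀ → (R ℕ.+ R ℕ.+ R) ℕ.* (I ℕ.+ I) ℕ.* q ℕ.* ν₀ ≡ 6 ℕ.* ((R ℕ.* q) ℕ.* (I ℕ.* ν₀))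
          id₁ = solve-∀ℕ
          id₂ : ∀ N ν₀ → 6 ℕ.* ((2 ℕ.* N ℕ.* ν₀) ℕ.* (6 ℕ.* (N ℕ.* N))) ≡ 72 ℕ.* (N ℕ.* N ℕ.* N) ℕ.* ν₀
          id₂ = solve-∀ℕ

      -- Dividing by g = gcd(y₀, x₀) stays inside the lattice because 0 < g ≤ 4N < q, and keeps y
      -- nonzero; minimality of ν₀ then forces g = 1.
      coprime : Coprime ∣ y₀ ∣ ∣ x₀ ∣
      coprime = gcd≡1⇒coprime (ℕ.≤-antisym g≤1 g≥1)
        where
        g = gcd ∣ y₀ ∣ ∣ x₀ ∣
        g∣y₀ : + g ∣ y₀
        g∣y₀ = ∣ᵤ⇒∣ (gcd[m,n]∣m ∣ y₀ ∣ ∣ x₀ ∣)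
        g∣x₀ : + g ∣ x₀
        g∣x₀ = ∣ᵤ⇒∣ (gcd[m,n]∣n ∣ y₀ ∣ ∣ x₀ ∣)
        g≤4N : g ℕ.≤ 4 ℕ.* N
        g≤4N = ℕ.≤-trans (ℕ.∣⇒≤ (gcd[m,n]∣m ∣ y₀ ∣ ∣ x₀ ∣)) y₀≤
        g≥1 : 1 ℕ.≤ g
        g≥1 = ℕ.n≢0⇒n>0 (λ g≡0 → ℕ.≢-nonZero⁻¹ ∣ y₀ ∣ (ℕ.0∣⇒≡0 (subst (ℕ._∣ ∣ y₀ ∣) g≡0 (gcd[m,n]∣m ∣ y₀ ∣ ∣ x₀ ∣))))
        instance _ = >-nonZero g≥1
        x₁ = _∣_.quotient g∣x₀
        y₁ = _∣_.quotient g∣y₀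
        x₀≡ : x₀ ≡ x₁ * + g
        x₀≡ = _∣_.equality g∣x₀
        y₀≡ : y₀ ≡ y₁ * + g
        y₀≡ = _∣_.equality g∣y₀
        ∣x₀∣≡ : ∣ x₀ ∣ ≡ ∣ x₁ ∣ ℕ.* g
        ∣x₀∣≡ = trans (cong ∣_∣ x₀≡) (abs-* x₁ (+ g))
        ∣y₀∣≡ : ∣ y₀ ∣ ≡ ∣ y₁ ∣ ℕ.* g
        ∣y₀∣≡ = trans (cong ∣_∣ y₀≡) (abs-* y₁ (+ g))
        y₁≢0 : y₁ ≢ 0ℤ
        y₁≢0 y₁≡0 = y₀≢0 (trans y₀≡ (cong (_* + g) y₁≡0))
        v₁∈L : (x₁ , y₁) ∈L
        v₁∈L = prime∣*-cancelˡ pq (+ g) (α * x₁ - γ * y₁)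
          (λ q∣g → contradiction (∣z⇒≡0 q∣g (ℕ.≤-<-trans g≤4N (ℕ.≤-<-trans (ℕ.*-monoˡ-≤ N (ℕ.m≤m+n 4 4)) 8N<q)))
                                 (λ g≡0 → ℕ.n>0⇒n≢0 g≥1 (cong ∣_∣ g≡0)))
          (subst (+ q ∣_) (trans (cong₂ (λ a b → α * a - γ * b) x₀≡ y₀≡) (identity α γ (+ g) x₁ y₁)) v₀∈L)
          where
          identity : ∀ α γ g x y → α * (x * g) - γ * (y * g) ≡ g * (α * x - γ * y)
          identity = solve-∀
        ν₁ = ν (x₁ , y₁)
        ν₀≡ : ν₀ ≡ ν₁ ℕ.* g
        ν₀≡ = trans (cong₂ (λ a b → a ℕ.+ N ℕ.* b) ∣x₀∣≡ ∣y₀∣≡) (identity ∣ x₁ ∣ ∣ y₁ ∣ N g)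
          where
          identity : ∀ a b N g → a ℕ.* g ℕ.+ N ℕ.* (b ℕ.* g) ≡ (a ℕ.+ N ℕ.* b) ℕ.* g
          identity = solve-∀ℕ
        ν₀≤ν₁ : ν₀ ℕ.≤ ν₁
        ν₀≤ν₁ = shortest (ℕ.≤-trans (subst (∣ x₁ ∣ ℕ.≤_) (sym ∣x₀∣≡) (ℕ.m≤m*n ∣ x₁ ∣ g)) x₀≤)
                         (ℕ.≤-trans (subst (∣ y₁ ∣ ℕ.≤_) (sym ∣y₀∣≡) (ℕ.m≤m*n ∣ y₁ ∣ g)) y₀≤) v₁∈L y₁≢0
        g≤1 : g ℕ.≤ 1
        g≤1 = ℕ.*-cancelˡ-≤ ν₀ (begin
          ν₀ ℕ.* g      ≤⟨ ℕ.*-monoˡ-≤ g ν₀≤ν₁ ⟩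
          ν₁ ℕ.* g      ≡⟨ ν₀≡ ⟨
          ν₀            ≡⟨ ℕ.*-identityʳ ν₀ ⟨
          ν₀ ℕ.* 1      ∎)
          where open ℕ.≤-Reasoning

      -- y₀ divides y₀ x = x₀ y and is coprime to x₀, so it divides y; the quotient is t.
      parallel⇒multiple : ∀ {x y} → det (x , y) ≡ 0ℤ → ∃[ t ] x ≡ t * x₀ × y ≡ t * y₀
      parallel⇒multiple {x} {y} parallel = t , ℤ.*-cancelʳ-≡ x (t * x₀) y₀ x*y₀≡ , y≡
        where
        x₀y≡y₀x : x₀ * y ≡ y₀ * x
        x₀y≡y₀x = ℤ.i-j≡0⇒i≡j (x₀ * y) (y₀ * x) parallel
        y₀∣y : y₀ ∣ y
        y₀∣y = ∣ᵤ⇒∣ (coprime-divisor coprime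
          (subst (∣ y₀ ∣ ℕ.∣_) (trans (sym (abs-* y₀ x)) (trans (cong ∣_∣ (sym x₀y≡y₀x)) (abs-* x₀ y))) (ℕ.m∣m*n ∣ x ∣)))
        t = _∣_.quotient y₀∣y
        y≡ : y ≡ t * y₀
        y≡ = _∣_.equality y₀∣y
        x*y₀≡ : x * y₀ ≡ t * x₀ * y₀
        x*y₀≡ = begin
          x * y₀          ≡⟨ ℤ.*-comm x y₀ ⟩
          y₀ * x          ≡⟨ x₀y≡y₀x ⟨
          x₀ * y          ≡⟨ cong (x₀ *_) y≡ ⟩
          x₀ * (t * y₀)   ≡⟨ identity x₀ t y₀ ⟩
          t * x₀ * y₀     ∎
          where
          open ≡-Reasoning
          identity : ∀ x₀ t y₀ → x₀ * (t * y₀) ≡ t * x₀ * y₀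
          identity = solve-∀

    Collinear : Set
    Collinear = ∃[ x₀ ] ∃[ y₀ ] y₀ ≢ 0ℤ × (x₀ , y₀) ∈L × ∣ x₀ ∣ ℕ.≤ 2 ℕ.* (N ℕ.* N) × ∣ y₀ ∣ ℕ.≤ 4 ℕ.* N ×
      (∀ {x y} → ∣ x ∣ ℕ.≤ N ℕ.* N → ∣ y ∣ ℕ.≤ 2 ℕ.* N → (x , y) ∈L → ∃[ t ] x ≡ t * x₀ × y ≡ t * y₀)

    -- The cases are separated by q ≤ 2Nν₀. If this fails, the determinants are multiples of q of
    -- absolute value at most 2Nν₀ < q, hence 0. If there is no candidate for a shortest vector, `S`
    -- is empty.
    few-or-collinear : length S ℕ.* q ℕ.≤ 72 ℕ.* (N ℕ.* N ℕ.* N) ⊎ Collinear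
    few-or-collinear with box (2 ℕ.* (N ℕ.* N)) (4 ℕ.* N) in eq
    ... | [] = inj₁ (subst (λ xs → length xs ℕ.* q ℕ.≤ 72 ℕ.* (N ℕ.* N ℕ.* N)) (sym (empty S ∈S⇒⊥)) z≤n)
      where
      empty : ∀ xs → (∀ {p : ℤ × ℤ} → p ∈ xs → ⊥) → xs ≡ []
      empty [] _ = refl
      empty (x ∷ xs) ∉xs = ⊥-elim (∉xs (here refl))
      ∈S⇒⊥ : ∀ {p} → p ∈ S → ⊥
      ∈S⇒⊥ {x , y} p∈ with x≤ , y≤ , l , y≢0 ← ∈-box⁻ p∈
        with () ← subst ((x , y) ∈_) eq (∈-box⁺ (ℕ.≤-trans x≤ (ℕ.m≤n*m (N ℕ.* N) 2)) (ℕ.≤-trans y≤ (ℕ.*-monoˡ-≤ N (ℕ.m≤m+n 2 2))) l y≢0)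
    ... | v ∷ vs = result (q ℕ.≤? 2 ℕ.* N ℕ.* ν₀)
      where
      v₀ = argmin ν v vs
      x₀ = proj₁ v₀
      y₀ = proj₂ v₀
      candidate : ∀ {x y} → (x , y) ∈ v ∷ vs → ∣ x ∣ ℕ.≤ 2 ℕ.* (N ℕ.* N) × ∣ y ∣ ℕ.≤ 4 ℕ.* N × (x , y) ∈L × y ≢ 0ℤ
      candidate p∈ = ∈-box⁻ (subst (_ ∈_) (sym eq) p∈)
      v₀-candidate : ∣ x₀ ∣ ℕ.≤ 2 ℕ.* (N ℕ.* N) × ∣ y₀ ∣ ℕ.≤ 4 ℕ.* N × (x₀ , y₀) ∈L × y₀ ≢ 0ℤ
      v₀-candidate = candidate (argmin-all ν {P = _∈ v ∷ vs} (here refl) (All.tabulate there))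
      shortest : ∀ {x y} → ∣ x ∣ ℕ.≤ 2 ℕ.* (N ℕ.* N) → ∣ y ∣ ℕ.≤ 4 ℕ.* N → (x , y) ∈L → y ≢ 0ℤ → ν (x₀ , y₀) ℕ.≤ ν (x , y)
      shortest x≤ y≤ l y≢0 with subst (_ ∈_) eq (∈-box⁺ x≤ y≤ l y≢0)
      ... | here refl = f[argmin]≤f[⊤] {f = ν} v vs
      ... | there p∈ = All.lookup (f[argmin]≤f[xs] {f = ν} v vs) p∈
      open Shortest (proj₁ (proj₂ (proj₂ v₀-candidate))) (proj₂ (proj₂ (proj₂ v₀-candidate)))
                    (proj₁ v₀-candidate) (proj₁ (proj₂ v₀-candidate)) shortest
      result : Dec (q ℕ.≤ 2 ℕ.* N ℕ.* ν₀) → length S ℕ.* q ℕ.≤ 72 ℕ.* (N ℕ.* N ℕ.* N) ⊎ Collinear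
      result (yes q≤) = inj₁ (∣S∣*q≤ q≤)
      result (no q≰) = inj₂ (x₀ , y₀ , proj₂ (proj₂ (proj₂ v₀-candidate)) , proj₁ (proj₂ (proj₂ v₀-candidate)) ,
        proj₁ v₀-candidate , proj₁ (proj₂ v₀-candidate) ,
        λ x≤ y≤ l → parallel⇒multiple (∣z⇒≡0 (∣-det l) (ℕ.≤-<-trans (∣det∣≤ x≤ y≤) (ℕ.≰⇒> q≰))))

  ∣a-b∣≤ : ∀ {a b M} → a ℕ.≤ M → b ℕ.≤ M → ∣ + a - + b ∣ ℕ.≤ M
  ∣a-b∣≤ {a} {b} a≤ b≤ = ℕ.≤-trans (subst (λ z → ∣ z ∣ ℕ.≤ a ℕ.⊔ b) (sym (m-n≡m⊖n a b)) (∣m⊝n∣≤m⊔n a b)) (ℕ.⊔-lub a≤ b≤)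

  square≡+ : ∀ z → z * z ≡ + (∣ z ∣ ℕ.* ∣ z ∣)
  square≡+ (+ n) = sym (pos-* n n)
  square≡+ -[1+ n ] = refl

  ∣square-square∣≤ : ∀ {k l M} → ∣ k ∣ ℕ.≤ M → ∣ l ∣ ℕ.≤ M → ∣ k * k - l * l ∣ ℕ.≤ M ℕ.* M
  ∣square-square∣≤ {k} {l} {M} k≤ l≤ = subst₂ (λ a b → ∣ a - b ∣ ℕ.≤ M ℕ.* M) (sym (square≡+ k)) (sym (square≡+ l))
    (∣a-b∣≤ (ℕ.*-mono-≤ k≤ k≤) (ℕ.*-mono-≤ l≤ l≤))

  difference-of-squares : ∀ k l → k * k - l * l ≡ (k - l) * (k + l)
  difference-of-squares = solve-∀

  -- Dividing k² - l² by the nonzero k - l gives k + l, and sum and difference give both numbers.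
  pair-determined : ∀ k l k′ l′ → k - l ≢ 0ℤ → k - l ≡ k′ - l′ → k * k - l * l ≡ k′ * k′ - l′ * l′ → k ≡ k′ × l ≡ l′
  pair-determined k l k′ l′ d≢0 d≡ x≡ = k≡ , l≡
    where
    instance _ = ℤ.≢-nonZero d≢0
    sum≡ : k + l ≡ k′ + l′
    sum≡ = ℤ.*-cancelˡ-≡ (k - l) _ _ (trans (sym (difference-of-squares k l)) (trans x≡
      (trans (difference-of-squares k′ l′) (cong (_* (k′ + l′)) (sym d≡)))))
    2k : ∀ k l → + 2 * k ≡ (k - l) + (k + l)
    2k = solve-∀
    k≡ : k ≡ k′
    k≡ = ℤ.*-cancelˡ-≡ (+ 2) k k′ (trans (2k k l) (trans (cong₂ _+_ d≡ sum≡) (sym (2k k′ l′))))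
    l≡ : l ≡ l′
    l≡ = trans (k+l-k k l) (trans (cong₂ _-_ sum≡ k≡) (sym (k+l-k k′ l′)))
      where
      k+l-k : ∀ k l → l ≡ k + l - k
      k+l-k = solve-∀

  -- a divides both n a and n m, hence n gcd(a, m); cancelling the gcd leaves v ∣ n.
  cofactor∣ : ∀ a m n .{{_ : NonZero a}} → a ℕ.∣ m ℕ.* n → ∃[ v ] a ≡ v ℕ.* gcd a m × v ℕ.∣ n
  cofactor∣ a m n a∣mn = v , a≡ , ℕ.*-cancelʳ-∣ g
    (subst₂ ℕ._∣_ a≡ (sym (c*gcd[m,n]≡gcd[cm,cn] n a m))
      (gcd-greatest (ℕ.n∣m*n n) (subst (a ℕ.∣_) (ℕ.*-comm m n) a∣mn)))
    where
    g = gcd a m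
    v = ℕ._∣_.quotient (gcd[m,n]∣m a m)
    a≡ : a ≡ v ℕ.* g
    a≡ = ℕ._∣_.equality (gcd[m,n]∣m a m)
    instance
      _ : NonZero g
      _ = ≢-nonZero (λ g≡0 → ≢-nonZero⁻¹ a (ℕ.0∣⇒≡0 (subst (ℕ._∣ a) g≡0 (gcd[m,n]∣m a m))))

  length-cartesianProduct : ∀ {A B : Set} (xs : List A) (ys : List B) → length (cartesianProduct xs ys) ≡ length xs ℕ.* length ys
  length-cartesianProduct [] ys = refl
  length-cartesianProduct (x ∷ xs) ys = trans (length-++ (map (x ,_) ys))
    (cong₂ ℕ._+_ (length-map (x ,_) ys) (length-cartesianProduct xs ys))

  -- Elements with squares among the multiples of j, and the lattice relation

  module Energy (q : ℕ) .{{_ : NonZero q}} (pq : Prime q) (j : Fin q) (j≢0 : j ≢ Residues.⟦_⟧ q 0) (N : ℕ) where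

    open Residues q
    open DecMembership (Fin._≟_ {q}) using (_∈?_)

    infix 4 _≈_
    _≈_ : ℤ → ℤ → Set
    a ≈ b = + q ∣ a - b

    ⌊_⌋ : 𝔽 → ℤ
    ⌊ b ⌋ = + toℕ b

    ⌊⟦⟧⌋ : ∀ n → ⌊ ⟦ n ⟧ ⌋ ≈ + n
    ⌊⟦⟧⌋ n = divides (- + (n / q)) (begin
      ⌊ ⟦ n ⟧ ⌋ - + n                              ≡⟨ cong (λ r → + r - + n) (toℕ-fromℕ< _) ⟩
      + (n % q) - + n                              ≡⟨ cong (λ m → + (n % q) - + m) (m≡m%n+[m/n]*n n q) ⟩
      + (n % q) - + (n % q ℕ.+ n / q ℕ.* q)        ≡⟨ cong (λ z → + (n % q) - z) (trans (pos-+ (n % q) _) (cong (λ z → + (n % q) + z) (pos-* (n / q) q))) ⟩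
      + (n % q) - (+ (n % q) + + (n / q) * + q)    ≡⟨ identity (+ (n % q)) (+ (n / q)) (+ q) ⟩
      - + (n / q) * + q                            ∎)
      where
      open ≡-Reasoning
      identity : ∀ r a q → r - (r + a * q) ≡ - a * q
      identity = solve-∀

    ⌊⊕⌋ : ∀ a b → ⌊ a ⊕ b ⌋ ≈ ⌊ a ⌋ + ⌊ b ⌋
    ⌊⊕⌋ a b = subst (⌊ a ⊕ b ⌋ ≈_) (pos-+ (toℕ a) (toℕ b)) (⌊⟦⟧⌋ (toℕ a ℕ.+ toℕ b))

    ⌊⊗⌋ : ∀ a b → ⌊ a ⊗ b ⌋ ≈ ⌊ a ⌋ * ⌊ b ⌋
    ⌊⊗⌋ a b = subst (⌊ a ⊗ b ⌋ ≈_) (pos-* (toℕ a) (toℕ b)) (⌊⟦⟧⌋ (toℕ a ℕ.* toℕ b))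

    ⌊⌋-injective : ∀ {a b} → ⌊ a ⌋ ≈ ⌊ b ⌋ → a ≡ b
    ⌊⌋-injective {a} {b} a≈b = toℕ-injective (ℤ.+-injective
      (ℤ.i-j≡0⇒i≡j ⌊ a ⌋ ⌊ b ⌋ (∣z⇒≡0 a≈b (∣r-r′∣< (toℕ<n a) (toℕ<n b)))))

    combine : ∀ {a b c} → + q ∣ a → + q ∣ b → c ≡ a + b → + q ∣ c
    combine q∣a q∣b refl = ∣m∣n⇒∣m+n q∣a q∣b

    J : ℤ
    J = ⌊ j ⌋

    ⌊0⌋≡0 : ⌊ ⟦ 0 ⟧ ⌋ ≡ 0ℤ
    ⌊0⌋≡0 = cong +_ (trans (toℕ-fromℕ< _) (m<n⇒m%n≡m (ℕ.>-nonZero⁻¹ q)))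

    ∣⇒≡⟦0⟧ : ∀ {a} → + q ∣ ⌊ a ⌋ → a ≡ ⟦ 0 ⟧
    ∣⇒≡⟦0⟧ {a} q∣a = ⌊⌋-injective (subst (+ q ∣_) (sym (trans (cong (λ z → ⌊ a ⌋ - z) ⌊0⌋≡0) (ℤ.+-identityʳ ⌊ a ⌋))) q∣a)

    q∤J : ¬ (+ q ∣ J)
    q∤J q∣J = j≢0 (∣⇒≡⟦0⟧ q∣J)

    InU : 𝔽 → Set
    InU b = b ⊗ b ∈ multiples j N

    inU? : Decidable InU
    inU? b = b ⊗ b ∈? multiples j N

    -- For b ∈ U, ind b is the n ∈ [1, N] with b² = n j; it is 0 off U.
    ind : 𝔽 → ℕ
    ind b with inU? b
    ... | yes b∈ = suc (proj₁ (∈-applyUpTo⁻ (λ n → ⟦ suc n ⟧ ⊗ j) b∈))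
    ... | no _ = 0

    ind≤ : ∀ {b} → InU b → ind b ℕ.≤ N
    ind≤ {b} b∈U with inU? b
    ... | yes b∈ = proj₁ (proj₂ (∈-applyUpTo⁻ (λ n → ⟦ suc n ⟧ ⊗ j) b∈))
    ... | no ∉ = contradiction b∈U ∉

    ind-square : ∀ b → InU b → ⌊ b ⌋ * ⌊ b ⌋ ≈ + ind b * J
    ind-square b b∈U with inU? b
    ... | no ∉ = contradiction b∈U ∉
    ... | yes b∈ with ∈-applyUpTo⁻ (λ n → ⟦ suc n ⟧ ⊗ j) b∈
    ...   | n , _ , b²≡ = combine (∣m⇒∣-m (⌊⊗⌋ b b))
      (combine (subst (λ z → ⌊ z ⌋ ≈ ⌊ ⟦ suc n ⟧ ⌋ * J) (sym b²≡) (⌊⊗⌋ ⟦ suc n ⟧ j)) (∣m⇒∣m*n J (⌊⟦⟧⌋ (suc n))) refl)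
      (identity ⌊ b ⌋ ⌊ b ⊗ b ⌋ ⌊ ⟦ suc n ⟧ ⌋ (+ suc n) J)
      where
      identity : ∀ b bb m n j → b * b - n * j ≡ - (bb - b * b) + ((bb - m * j) + (m - n) * j)
      identity = solve-∀

    ∣ind-ind∣≤ : ∀ {a b} → InU a → InU b → ∣ + ind a - + ind b ∣ ℕ.≤ N
    ∣ind-ind∣≤ a∈ b∈ = ∣a-b∣≤ (ind≤ a∈) (ind≤ b∈)

    infixl 6 _⊖_
    _⊖_ : 𝔽 → 𝔽 → 𝔽
    a ⊖ b = ⟦ toℕ a ℕ.+ (q ℕ.∸ toℕ b) ⟧

    ⌊⊖⌋ : ∀ a b → ⌊ a ⊖ b ⌋ ≈ ⌊ a ⌋ - ⌊ b ⌋
    ⌊⊖⌋ a b = combine (⌊⟦⟧⌋ (toℕ a ℕ.+ (q ℕ.∸ toℕ b))) (divides (+ 1) refl)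
      (begin
        ⌊ a ⊖ b ⌋ - (⌊ a ⌋ - ⌊ b ⌋)                                  ≡⟨ identity ⌊ a ⊖ b ⌋ ⌊ a ⌋ ⌊ b ⌋ (+ (q ℕ.∸ toℕ b)) ⟩
        ⌊ a ⊖ b ⌋ - (⌊ a ⌋ + + (q ℕ.∸ toℕ b)) + + 1 * (+ (q ℕ.∸ toℕ b) + ⌊ b ⌋) ≡⟨ cong₂ (λ u v → ⌊ a ⊖ b ⌋ - u + + 1 * v) (sym (pos-+ (toℕ a) _))
                                                                             (trans (sym (pos-+ (q ℕ.∸ toℕ b) (toℕ b))) (cong +_ (ℕ.m∸n+n≡m (ℕ.<⇒≤ (toℕ<n b))))) ⟩
        ⌊ a ⊖ b ⌋ - + (toℕ a ℕ.+ (q ℕ.∸ toℕ b)) + + 1 * + q            ∎)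
      where
      open ≡-Reasoning
      identity : ∀ h a b c → h - (a - b) ≡ h - (a + c) + + 1 * (c + b)
      identity = solve-∀

    InUU : 𝔽 → 𝔽 → Set
    InUU h b = InU b × InU (b ⊕ h)

    inUU? : ∀ h → Decidable (InUU h)
    inUU? h b = inU? b ×-dec inU? (b ⊕ h)

    UU : 𝔽 → List 𝔽
    UU h = filter (inUU? h) (allFin q)

    ∈-UU⁺ : ∀ {h b} → InUU h b → b ∈ UU h
    ∈-UU⁺ {h} {b} = ∈-filter⁺ (inUU? h) (∈-allFin b)

    ∈-UU⁻ : ∀ {h b} → b ∈ UU h → InUU h b
    ∈-UU⁻ {h} b∈ = proj₂ (∈-filter⁻ (inUU? h) {xs = allFin q} b∈)

    UU-unique : ∀ h → Unique (UU h)
    UU-unique h = Unique.filter⁺ (inUU? h) (Unique.allFin⁺ q)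

    -- If b² = n j and (b + h)² = m j then k = m - n and s = m + n.
    k s : 𝔽 → 𝔽 → ℤ
    k h b = + ind (b ⊕ h) - + ind b
    s h b = + (ind (b ⊕ h) ℕ.+ ind b)

    X Y : 𝔽 → 𝔽 → 𝔽 → ℤ
    X h b b′ = k h b * k h b - k h b′ * k h b′
    Y h b b′ = s h b - s h b′

    module _ {h : 𝔽} where

      private
        H : ℤ
        H = ⌊ h ⌋

      ∣k∣≤ : ∀ {b} → InUU h b → ∣ k h b ∣ ℕ.≤ N
      ∣k∣≤ (b∈ , b+h∈) = ∣ind-ind∣≤ b+h∈ b∈

      ∣X∣≤ : ∀ {b b′} → InUU h b → InUU h b′ → ∣ X h b b′ ∣ ℕ.≤ N ℕ.* N
      ∣X∣≤ {b} {b′} b∈ b′∈ = ∣square-square∣≤ {k h b} {k h b′} (∣k∣≤ b∈) (∣k∣≤ b′∈)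

      ∣Y∣≤ : ∀ {b b′} → InUU h b → InUU h b′ → ∣ Y h b b′ ∣ ℕ.≤ 2 ℕ.* N
      ∣Y∣≤ {b} {b′} (b∈ , b+h∈) (b′∈ , b′+h∈) = ∣a-b∣≤ (bound b+h∈ b∈) (bound b′+h∈ b′∈)
        where
        bound : ∀ {a c} → InU a → InU c → ind a ℕ.+ ind c ℕ.≤ 2 ℕ.* N
        bound a∈ c∈ = ℕ.+-mono-≤ (ind≤ a∈) (ℕ.≤-trans (ind≤ c∈) (ℕ.≤-reflexive (sym (ℕ.+-identityʳ N))))

      shift-square : ∀ {b} → InUU h b → (⌊ b ⌋ + H) * (⌊ b ⌋ + H) ≈ + ind (b ⊕ h) * J
      shift-square {b} (_ , b+h∈) = combine (∣m⇒∣-m (∣m⇒∣m*n (⌊ b ⊕ h ⌋ + (⌊ b ⌋ + H)) (⌊⊕⌋ b h))) (ind-square (b ⊕ h) b+h∈)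
        (identity ⌊ b ⊕ h ⌋ (⌊ b ⌋ + H) (+ ind (b ⊕ h) * J))
        where
        identity : ∀ c d m → d * d - m ≡ - ((c - d) * (c + d)) + (c * c - m)
        identity = solve-∀

      J*k≈ : ∀ {b} → InUU h b → J * k h b ≈ H * (+ 2 * ⌊ b ⌋ + H)
      J*k≈ {b} p@(b∈ , _) = combine (∣m⇒∣-m (shift-square p)) (ind-square b b∈)
        (identity J H ⌊ b ⌋ (+ ind (b ⊕ h)) (+ ind b))
        where
        identity : ∀ j h b m n → j * (m - n) - h * (+ 2 * b + h) ≡ - ((b + h) * (b + h) - m * j) + (b * b - n * j)
        identity = solve-∀

      -- Parallelogram law: 2(b + h)² + 2b² = (2b + h)² + h².
      2J*s≈ : ∀ {b} → InUU h b → + 2 * J * s h b ≈ (+ 2 * ⌊ b ⌋ + H) * (+ 2 * ⌊ b ⌋ + H) + H * H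
      2J*s≈ {b} p@(b∈ , _) = combine (∣n⇒∣m*n (- + 2) (shift-square p)) (∣n⇒∣m*n (- + 2) (ind-square b b∈))
        (trans (cong (λ t → + 2 * J * t - ((+ 2 * ⌊ b ⌋ + H) * (+ 2 * ⌊ b ⌋ + H) + H * H)) (pos-+ (ind (b ⊕ h)) (ind b)))
               (identity J H ⌊ b ⌋ (+ ind (b ⊕ h)) (+ ind b)))
        where
        identity : ∀ j h b m n → + 2 * j * (m + n) - ((+ 2 * b + h) * (+ 2 * b + h) + h * h) ≡
                   - + 2 * ((b + h) * (b + h) - m * j) + - + 2 * (b * b - n * j)
        identity = solve-∀

      -- With B = 2b + h, squaring j k = h B gives j² (k² - k′²) = h² (B² - B′²), and 2 j (s - s′) =
      -- B² - B′² since h² cancels. Eliminating B² - B′² leaves the claim times j.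
      J*X≈ : ∀ {b b′} → InUU h b → InUU h b′ → J * X h b b′ ≈ + 2 * (H * H) * Y h b b′
      J*X≈ {b} {b′} p p′ = prime∣*-cancelˡ pq J (J * X h b b′ - + 2 * (H * H) * Y h b b′) q∤J
        (combine (∣m∣n⇒∣m-n (∣m⇒∣m*n (J * κ + H * B) (J*k≈ p)) (∣m⇒∣m*n (J * κ′ + H * B′) (J*k≈ p′)))
                 (∣n⇒∣m*n (H * H) (∣m∣n⇒∣m-n (2J*s≈ p′) (2J*s≈ p)))
                 (identity J H κ B κ′ B′ (s h b) (s h b′)))
        where
        κ = k h b
        κ′ = k h b′
        B = + 2 * ⌊ b ⌋ + H
        B′ = + 2 * ⌊ b′ ⌋ + H
        identity : ∀ j h k B k′ B′ s s′ → j * (j * (k * k - k′ * k′) - + 2 * (h * h) * (s - s′)) ≡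
          (j * k - h * B) * (j * k + h * B) - (j * k′ - h * B′) * (j * k′ + h * B′)
          + h * h * ((+ 2 * j * s′ - (B′ * B′ + h * h)) - (+ 2 * j * s - (B * B + h * h)))
        identity = solve-∀

  -- The list of possible x₀, independent of h

  divisorPairs : ℕ → List (ℕ × ℕ)
  divisorPairs l = pairs (divisors l) (λ _ → divisors l)

  divisorTriples : ℕ → List (ℕ × ℕ × ℕ)
  divisorTriples M = pairs (map suc (upTo M)) divisorPairs

  product₂ : ℕ × ℕ × ℕ → ℕ
  product₂ (_ , u , v) = u ℕ.* v

  products : ℕ → List ℤ
  products M = signed (map product₂ (divisorTriples M))

  ∈-products : ∀ {M} z {l u v} → l ≢ 0 → l ℕ.≤ M → u ℕ.∣ l → v ℕ.∣ l → ∣ z ∣ ≡ u ℕ.* v → z ∈ products M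
  ∈-products z {zero} l≢0 = contradiction refl l≢0
  ∈-products {M} z {suc l} {u} {v} _ l<M u∣l v∣l z≡ = ∈-signed z (subst (_∈ map product₂ (divisorTriples M)) (sym z≡)
    (∈-map⁺ product₂ (∈-pairs {f = divisorPairs} (∈-map⁺ suc (∈-upTo⁺ l<M))
      (∈-pairs {f = λ _ → divisors (suc l)} (∈-divisors u∣l) (∈-divisors v∣l)))))

  length-products : ∀ {M D} → (∀ {n} → n ℕ.≤ M → τ n ℕ.≤ D) → length (products M) ℕ.≤ 2 ℕ.* (M ℕ.* (D ℕ.* D))
  length-products {M} {D} τ≤D = begin
    length (products M)                         ≡⟨ length-signed (map product₂ (divisorTriples M)) ⟩
    2 ℕ.* length (map product₂ (divisorTriples M)) ≡⟨ cong (2 ℕ.*_) (length-map product₂ (divisorTriples M)) ⟩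
    2 ℕ.* length (divisorTriples M)             ≤⟨ ℕ.*-monoʳ-≤ 2 (length-pairs (map suc (upTo M)) {divisorPairs} inner) ⟩
    2 ℕ.* (length (map suc (upTo M)) ℕ.* (D ℕ.* D)) ≡⟨ cong (λ m → 2 ℕ.* (m ℕ.* (D ℕ.* D))) (trans (length-map suc (upTo M)) (length-upTo M)) ⟩
    2 ℕ.* (M ℕ.* (D ℕ.* D))                     ∎
    where
    open ℕ.≤-Reasoning
    inner : ∀ {l} → l ∈ map suc (upTo M) → length (divisorPairs l) ℕ.≤ D ℕ.* D
    inner {l} l∈ with m , m∈ , refl ← ∈-map⁻ suc l∈ =
      ℕ.≤-trans (length-pairs (divisors l) {λ _ → divisors l} (λ _ → τ≤D (∈-upTo⁻ m∈)))
                (ℕ.*-monoˡ-≤ D (τ≤D (∈-upTo⁻ m∈)))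

  -- (r - 2)² ≥ 0, split at r = 2 to remain within the natural numbers.
  4r≤r²+4 : ∀ r → r ℕ.* 4 ℕ.≤ r ℕ.* r ℕ.+ 4
  4r≤r²+4 0 = z≤n
  4r≤r²+4 1 = ℕ.n≤1+n 4
  4r≤r²+4 (suc (suc s)) = subst (suc (suc s) ℕ.* 4 ℕ.≤_) (identity s) (ℕ.m≤m+n (suc (suc s) ℕ.* 4) (s ℕ.* s))
    where
    identity : ∀ s → suc (suc s) ℕ.* 4 ℕ.+ s ℕ.* s ≡ suc (suc s) ℕ.* suc (suc s) ℕ.+ 4
    identity = solve-∀ℕ

  -- The linear term is absorbed by 4r ≤ r² + 4, giving r² ≤ 4 + 4SD, and so r² q ≤ 4q + 288 D n.
  -- Here 288 is rounded up to 289 = 17², so that a square root can be taken later.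
  r²q≤ : ∀ r S D q n → 1 ℕ.≤ D → r ℕ.* r ℕ.≤ r ℕ.* 2 ℕ.+ S ℕ.* (2 ℕ.* D) → S ℕ.* q ℕ.≤ 72 ℕ.* n →
         r ℕ.* r ℕ.* q ℕ.≤ 289 ℕ.* (D ℕ.* D) ℕ.* (n ℕ.+ q)
  r²q≤ r S D q n 1≤D r²≤ Sq≤ = begin
    r ℕ.* r ℕ.* q                                    ≤⟨ ℕ.*-monoˡ-≤ q r²≤′ ⟩
    (4 ℕ.+ 4 ℕ.* (S ℕ.* D)) ℕ.* q                    ≡⟨ id₁ S D q ⟩
    4 ℕ.* q ℕ.+ (4 ℕ.* D) ℕ.* (S ℕ.* q)              ≤⟨ ℕ.+-monoʳ-≤ (4 ℕ.* q) (ℕ.*-monoʳ-≤ (4 ℕ.* D) Sq≤) ⟩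
    4 ℕ.* q ℕ.+ (4 ℕ.* D) ℕ.* (72 ℕ.* n)             ≡⟨ id₂ D q n ⟩
    4 ℕ.* q ℕ.+ (288 ℕ.* D) ℕ.* n                    ≤⟨ ℕ.+-mono-≤ (ℕ.*-monoˡ-≤ q (ℕ.≤-trans (ℕ.m≤m+n 4 285) (ℕ.m≤m*n 289 (D ℕ.* D))))
                                                          (ℕ.*-monoˡ-≤ n (ℕ.*-mono-≤ (ℕ.n≤1+n 288) (ℕ.m≤m*n D D))) ⟩
    c ℕ.* q ℕ.+ c ℕ.* n                              ≡⟨ ℕ.*-distribˡ-+ c q n ⟨
    c ℕ.* (q ℕ.+ n)                                  ≡⟨ cong (c ℕ.*_) (ℕ.+-comm q n) ⟩
    c ℕ.* (n ℕ.+ q)                                  ∎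
    where
    open ℕ.≤-Reasoning
    c = 289 ℕ.* (D ℕ.* D)
    instance
      D-nonZero : NonZero D
      D-nonZero = >-nonZero 1≤D
      D²-nonZero : NonZero (D ℕ.* D)
      D²-nonZero = ℕ.m*n≢0 D D
    id₁ : ∀ S D q → (4 ℕ.+ 4 ℕ.* (S ℕ.* D)) ℕ.* q ≡ 4 ℕ.* q ℕ.+ (4 ℕ.* D) ℕ.* (S ℕ.* q)
    id₁ = solve-∀ℕ
    id₂ : ∀ D q n → 4 ℕ.* q ℕ.+ (4 ℕ.* D) ℕ.* (72 ℕ.* n) ≡ 4 ℕ.* q ℕ.+ (288 ℕ.* D) ℕ.* n
    id₂ = solve-∀ℕ
    id₃ : ∀ r S D → (r ℕ.* 2 ℕ.+ S ℕ.* (2 ℕ.* D)) ℕ.+ (r ℕ.* 2 ℕ.+ S ℕ.* (2 ℕ.* D)) ≡ r ℕ.* 4 ℕ.+ 4 ℕ.* (S ℕ.* D)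
    id₃ = solve-∀ℕ
    r²≤′ : r ℕ.* r ℕ.≤ 4 ℕ.+ 4 ℕ.* (S ℕ.* D)
    r²≤′ = ℕ.+-cancelˡ-≤ (r ℕ.* r) _ _ (begin
      r ℕ.* r ℕ.+ r ℕ.* r                                ≤⟨ ℕ.+-mono-≤ r²≤ r²≤ ⟩
      (r ℕ.* 2 ℕ.+ S ℕ.* (2 ℕ.* D)) ℕ.+ (r ℕ.* 2 ℕ.+ S ℕ.* (2 ℕ.* D)) ≡⟨ id₃ r S D ⟩
      r ℕ.* 4 ℕ.+ 4 ℕ.* (S ℕ.* D)                        ≤⟨ ℕ.+-monoˡ-≤ (4 ℕ.* (S ℕ.* D)) (4r≤r²+4 r) ⟩
      r ℕ.* r ℕ.+ 4 ℕ.+ 4 ℕ.* (S ℕ.* D)                  ≡⟨ ℕ.+-assoc (r ℕ.* r) 4 (4 ℕ.* (S ℕ.* D)) ⟩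
      r ℕ.* r ℕ.+ (4 ℕ.+ 4 ℕ.* (S ℕ.* D))                ∎)

  divisor-bound≥1 : ∀ N .{{_ : NonZero N}} {D} → (∀ {n} → n ℕ.≤ 8 ℕ.* (N ℕ.* N ℕ.* N) → τ n ℕ.≤ D) → 1 ℕ.≤ D
  divisor-bound≥1 N τ≤D = τ≤D (ℕ.*-mono-≤ (s≤s (z≤n {7})) (ℕ.>-nonZero⁻¹ (N ℕ.* N ℕ.* N) {{ℕ.m*n≢0 (N ℕ.* N) N {{ℕ.m*n≢0 N N}}}}))

  -- A single h ≠ 0: few points, or structured lattice vectors

  module Fibre (q : ℕ) .{{_ : NonZero q}} (pq : Prime q) (j : Fin q) (j≢0 : j ≢ Residues.⟦_⟧ q 0)
               (N : ℕ) .{{_ : NonZero N}} (8N<q : 8 ℕ.* N ℕ.< q)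
               (D : ℕ) (τ≤D : ∀ {n} → n ℕ.≤ 8 ℕ.* (N ℕ.* N ℕ.* N) → τ n ℕ.≤ D)
               (h : Fin q) (h≢0 : h ≢ Residues.⟦_⟧ q 0) where

    open Residues q
    open Energy q pq j j≢0 N

    H : ℤ
    H = ⌊ h ⌋

    q∤H : ¬ (+ q ∣ H)
    q∤H q∣H = h≢0 (∣⇒≡⟦0⟧ q∣H)

    small : ∀ {n} → n ℕ.≤ 8 ℕ.* N → n ℕ.< q
    small n≤ = ℕ.≤-<-trans n≤ 8N<q

    q∤2 : ¬ (+ q ∣ + 2)
    q∤2 q∣2 with () ← ∣z⇒≡0 q∣2 (small (ℕ.≤-trans (ℕ.m≤m+n 2 6) (ℕ.m≤m*n 8 N)))

    q∤2H² : ¬ (+ q ∣ + 2 * (H * H))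
    q∤2H² q∣ = q∤H (prime∣*-cancelˡ pq H H q∤H (prime∣*-cancelˡ pq (+ 2) (H * H) q∤2 q∣))

    open Lattice pq J (+ 2 * (H * H)) q∤J q∤2H² N 8N<q public

    -- j k = h (2b + h), and q divides neither 2 nor h.
    k-injective : ∀ {b b′} → InUU h b → InUU h b′ → k h b ≡ k h b′ → b ≡ b′
    k-injective {b} {b′} p p′ k≡ = ⌊⌋-injective
      (prime∣*-cancelˡ pq (+ 2) (⌊ b ⌋ - ⌊ b′ ⌋) q∤2 (prime∣*-cancelˡ pq H (+ 2 * (⌊ b ⌋ - ⌊ b′ ⌋)) q∤H
        (combine (∣m⇒∣-m (J*k≈ p)) (subst (λ z → J * z ≈ H * (+ 2 * ⌊ b′ ⌋ + H)) (sym k≡) (J*k≈ p′))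
                 (identity J H (k h b) ⌊ b ⌋ ⌊ b′ ⌋))))
      where
      identity : ∀ j h k b b′ → h * (+ 2 * (b - b′)) ≡ - (j * k - h * (+ 2 * b + h)) + (j * k - h * (+ 2 * b′ + h))
      identity = solve-∀

    ∣k-k∣≤ : ∀ {b b′} → InUU h b → InUU h b′ → ∣ k h b - k h b′ ∣ ℕ.≤ 2 ℕ.* N
    ∣k-k∣≤ {b} {b′} p p′ = ℕ.≤-trans (∣i-j∣≤∣i∣+∣j∣ (k h b) (k h b′))
      (ℕ.+-mono-≤ (∣k∣≤ p) (ℕ.≤-trans (∣k∣≤ p′) (ℕ.≤-reflexive (sym (ℕ.+-identityʳ N)))))

    ∣k+k∣≤ : ∀ {b b′} → InUU h b → InUU h b′ → ∣ k h b + k h b′ ∣ ℕ.≤ 2 ℕ.* N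
    ∣k+k∣≤ {b} {b′} p p′ = ℕ.≤-trans (∣i+j∣≤∣i∣+∣j∣ (k h b) (k h b′))
      (ℕ.+-mono-≤ (∣k∣≤ p) (ℕ.≤-trans (∣k∣≤ p′) (ℕ.≤-reflexive (sym (ℕ.+-identityʳ N)))))

    2N<q : 2 ℕ.* N ℕ.< q
    2N<q = small (ℕ.*-monoˡ-≤ N (ℕ.m≤m+n 2 6))

    Equal : 𝔽 → 𝔽 → Set
    Equal b b′ = k h b′ ≡ k h b ⊎ k h b′ ≡ - k h b

    -- If s = s′, the lattice relation gives q ∣ (k - k′)(k + k′). Both factors are smaller than q,
    -- so one of them is 0. The exceptional pairs leave at most two b′ for each b.
    equal-or-Y≢0 : ∀ {b b′} → InUU h b → InUU h b′ → Equal b b′ ⊎ (Y h b b′ ≢ 0ℤ × k h b - k h b′ ≢ 0ℤ)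
    equal-or-Y≢0 {b} {b′} p p′ with k h b′ ℤ.≟ k h b | Y h b b′ ℤ.≟ 0ℤ
    ... | yes k≡ | _ = inj₁ (inj₁ k≡)
    ... | no k≢ | no Y≢0 = inj₂ (Y≢0 , λ d≡0 → k≢ (sym (ℤ.i-j≡0⇒i≡j (k h b) (k h b′) d≡0)))
    ... | no k≢ | yes Y≡0 = inj₁ ([ (λ q∣d → contradiction (sym (ℤ.i-j≡0⇒i≡j (k h b) (k h b′) (∣z⇒≡0 q∣d (ℕ.≤-<-trans (∣k-k∣≤ p p′) 2N<q)))) k≢)
                                  , (λ q∣s → inj₂ (opposite (∣z⇒≡0 q∣s (ℕ.≤-<-trans (∣k+k∣≤ p p′) 2N<q)))) ]′
      (prime∣* pq (k h b - k h b′) (k h b + k h b′) (subst (+ q ∣_) (difference-of-squares (k h b) (k h b′)) q∣X)))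
      where
      q∣X : + q ∣ X h b b′
      q∣X = prime∣*-cancelˡ pq J (X h b b′) q∤J
        (combine (J*X≈ p p′) (∣n⇒∣m*n (+ 2 * (H * H)) (divides (+ 0) Y≡0)) (identity (J * X h b b′) (+ 2 * (H * H) * Y h b b′)))
        where
        identity : ∀ a b → a ≡ (a - b) + b
        identity = solve-∀
      opposite : k h b + k h b′ ≡ 0ℤ → k h b′ ≡ - k h b
      opposite eq = trans (identity (k h b) (k h b′)) (trans (cong (_- k h b) eq) (ℤ.+-identityˡ (- k h b)))
        where
        identity : ∀ k l → l ≡ k + l - k
        identity = solve-∀

    r : ℕ
    r = length (UU h)

    EqualCode : 𝔽 × 𝔽 → 𝔽 × Bool → Set
    EqualCode (b , b′) (c , σ) = InUU h b′ × b ≡ c × k h b′ ≡ (if σ then k h c else - k h c)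

    -- One vector may come from several pairs; the divisor d of x = (k - k′)(k + k′) tells them
    -- apart, and d ≠ 0 is what `pair-determined` asks for.
    DivisorCode : 𝔽 × 𝔽 → (ℤ × ℤ) × ℤ → Set
    DivisorCode (b , b′) ((x , _) , d) = InUU h b × InUU h b′ × x ≡ X h b b′ × d ≡ k h b - k h b′ × d ≢ 0ℤ

    equalCodes : List (𝔽 × Bool)
    equalCodes = pairs (UU h) (λ _ → true ∷ false ∷ [])

    divisorCodes : List ((ℤ × ℤ) × ℤ)
    divisorCodes = pairs S (λ (x , _) → signedDivisors x)

    k-k∈divisors : ∀ {b b′} → X h b b′ ≢ 0ℤ → k h b - k h b′ ∈ signedDivisors (X h b b′)
    k-k∈divisors {b} {b′} X≢0 = ∈-signedDivisors {z = X h b b′} X≢0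
      (divides (k h b + k h b′) (trans (difference-of-squares (k h b) (k h b′)) (ℤ.*-comm (k h b - k h b′) (k h b + k h b′))))

    X≢0 : ∀ {b b′} → InUU h b → InUU h b′ → Y h b b′ ≢ 0ℤ → X h b b′ ≢ 0ℤ
    X≢0 {b} {b′} p p′ Y≢0 X≡0 = Y≢0 (∣z⇒≡0 (prime∣*-cancelˡ pq (+ 2 * (H * H)) (Y h b b′) q∤2H²
      (combine (∣m⇒∣-m (J*X≈ p p′)) (∣n⇒∣m*n J (divides (+ 0) X≡0)) (identity (J * X h b b′) (+ 2 * (H * H) * Y h b b′))))
      (ℕ.≤-<-trans (∣Y∣≤ p p′) 2N<q))
      where
      identity : ∀ a b → b ≡ - (a - b) + a
      identity = solve-∀

    XY∈S : ∀ {b b′} → InUU h b → InUU h b′ → Y h b b′ ≢ 0ℤ → (X h b b′ , Y h b b′) ∈ S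
    XY∈S {b} {b′} p p′ Y≢0 = ∈-box⁺ {N ℕ.* N} {2 ℕ.* N} {X h b b′} {Y h b b′} (∣X∣≤ p p′) (∣Y∣≤ p p′) (J*X≈ p p′) Y≢0

    pair-coded : ∀ {b b′} → InUU h b → InUU h b′ →
                 Coded EqualCode equalCodes (b , b′) ⊎ Coded DivisorCode divisorCodes (b , b′)
    pair-coded {b} {b′} p p′ = [ equal , (λ (Y≢0 , d≢0) → inj₂ (distinct Y≢0 d≢0)) ]′ (equal-or-Y≢0 p p′)
      where
      equal : Equal b b′ → Coded EqualCode equalCodes (b , b′) ⊎ Coded DivisorCode divisorCodes (b , b′)
      equal (inj₁ k≡) = inj₁ ((b , true) , ∈-pairs {f = λ _ → true ∷ false ∷ []} (∈-UU⁺ p) (here refl) , p′ , refl , k≡)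
      equal (inj₂ k≡) = inj₁ ((b , false) , ∈-pairs {f = λ _ → true ∷ false ∷ []} (∈-UU⁺ p) (there (here refl)) , p′ , refl , k≡)
      distinct : Y h b b′ ≢ 0ℤ → k h b - k h b′ ≢ 0ℤ → Coded DivisorCode divisorCodes (b , b′)
      distinct Y≢0 d≢0 = ((X h b b′ , Y h b b′) , k h b - k h b′) ,
        ∈-pairs {f = λ (x , _) → signedDivisors x} (XY∈S p p′ Y≢0) (k-k∈divisors {b} {b′} (X≢0 p p′ Y≢0)) ,
        p , p′ , refl , refl , d≢0

    -- The exceptional pairs number at most two for each b; every other pair is a vector of `S` with
    -- one of the at most 2D signed divisors of its x.
    r²≤ : r ℕ.* r ℕ.≤ r ℕ.* 2 ℕ.+ length S ℕ.* (2 ℕ.* D)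
    r²≤ = begin
      r ℕ.* r                                    ≡⟨ length-cartesianProduct (UU h) (UU h) ⟨
      length (cartesianProduct (UU h) (UU h))    ≤⟨ atMost-∪ (atMost-coded {R = EqualCode} equal-injective equalCodes)
                                                             (atMost-coded {R = DivisorCode} divisor-injective divisorCodes)
                                                      (cartesianProduct (UU h) (UU h)) (Unique.cartesianProduct⁺ (UU-unique h) (UU-unique h))
                                                      (All.tabulate λ {(b , b′)} bb′∈ → let b∈ , b′∈ = ∈-cartesianProduct⁻ (UU h) (UU h) bb′∈ in pair-coded (∈-UU⁻ b∈) (∈-UU⁻ b′∈)) ⟩
      length equalCodes ℕ.+ length divisorCodes  ≤⟨ ℕ.+-mono-≤ (length-pairs (UU h) {λ _ → true ∷ false ∷ []} (λ _ → ℕ.≤-refl))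
                                                      (length-pairs S {λ (x , _) → signedDivisors x} divisors≤) ⟩
      r ℕ.* 2 ℕ.+ length S ℕ.* (2 ℕ.* D)         ∎
      where
      open ℕ.≤-Reasoning
      equal-injective : ∀ x y c → EqualCode x c → EqualCode y c → x ≡ y
      equal-injective _ _ _ (p , refl , k≡) (p′ , refl , k′≡) = cong₂ _,_ refl (k-injective p p′ (trans k≡ (sym k′≡)))
      divisor-injective : ∀ x y c → DivisorCode x c → DivisorCode y c → x ≡ y
      divisor-injective (b , b′) (c , c′) _ (p , p′ , x≡ , d≡ , d≢0) (o , o′ , x≡′ , d≡′ , _) =
        let k≡ , k′≡ = pair-determined (k h b) (k h b′) (k h c) (k h c′) (λ eq → d≢0 (trans d≡ eq)) (trans (sym d≡) d≡′) (trans (sym x≡) x≡′)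
        in cong₂ _,_ (k-injective p o k≡) (k-injective p′ o′ k′≡)
      divisors≤ : ∀ {v} → v ∈ S → length (signedDivisors (proj₁ v)) ℕ.≤ 2 ℕ.* D
      divisors≤ {x , y} v∈ = let x≤ , _ = ∈-box⁻ {N ℕ.* N} {2 ℕ.* N} v∈ in
        ℕ.≤-trans (ℕ.≤-reflexive (length-signed (divisors ∣ x ∣)))
          (ℕ.*-monoʳ-≤ 2 (τ≤D (ℕ.≤-trans x≤ (ℕ.≤-trans (ℕ.m≤m*n (N ℕ.* N) N) (ℕ.m≤n*m (N ℕ.* N ℕ.* N) 8)))))

    1≤D : 1 ℕ.≤ D
    1≤D = divisor-bound≥1 N τ≤D

    -- This is r ≤ 17 D √(N³/q + 1), squared and cleared of denominators.
    Small : Set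
    Small = r ℕ.* r ℕ.* q ℕ.≤ 289 ℕ.* (D ℕ.* D) ℕ.* (N ℕ.* N ℕ.* N ℕ.+ q)

    few⇒small : length S ℕ.* q ℕ.≤ 72 ℕ.* (N ℕ.* N ℕ.* N) → Small
    few⇒small = r²q≤ r (length S) D q (N ℕ.* N ℕ.* N) 1≤D r²≤

    r≤D⇒small : r ℕ.≤ D → Small
    r≤D⇒small r≤D = begin
      r ℕ.* r ℕ.* q                          ≤⟨ ℕ.*-mono-≤ (ℕ.*-mono-≤ r≤D r≤D) (ℕ.m≤n+m q (N ℕ.* N ℕ.* N)) ⟩
      D ℕ.* D ℕ.* (N ℕ.* N ℕ.* N ℕ.+ q)      ≤⟨ ℕ.*-monoˡ-≤ (N ℕ.* N ℕ.* N ℕ.+ q) (ℕ.m≤n*m (D ℕ.* D) 289) ⟩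
      289 ℕ.* (D ℕ.* D) ℕ.* (N ℕ.* N ℕ.* N ℕ.+ q) ∎
      where open ℕ.≤-Reasoning

    -- Pigeonhole on gcd(x₀, k b - k b₀): two points b, b′ of the fibre sharing this gcd u have
    -- both u and x₀ / u dividing k b - k b′.
    module _ {x₀ : ℤ} (x₀≢0 : x₀ ≢ 0ℤ) (τ<r : τ ∣ x₀ ∣ ℕ.< r)
             (x₀∣X : ∀ {b b′} → InUU h b → InUU h b′ → x₀ ∣ X h b b′) where

      private
        a : ℕ
        a = ∣ x₀ ∣
        instance
          a-nonZero : NonZero a
          a-nonZero = ≢-nonZero (x₀≢0 ∘ ∣i∣≡0⇒i≡0)
        point : Fin r → 𝔽
        point = lookup (UU h)
        point∈ : ∀ i → InUU h (point i)
        point∈ i = ∈-UU⁻ (∈-lookup {xs = UU h} i)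
        b₀ : 𝔽
        b₀ = point (Fin.fromℕ< (ℕ.≤-<-trans z≤n τ<r))
        b₀∈ : InUU h b₀
        b₀∈ = point∈ _
        diff add : Fin r → ℤ
        diff i = k h (point i) - k h b₀
        add i = k h (point i) + k h b₀
        g : Fin r → ℕ
        g i = gcd a ∣ diff i ∣
        g∈ : ∀ i → g i ∈ divisors a
        g∈ i = ∈-divisors (gcd[m,n]∣m a ∣ diff i ∣)
        cofactor : ∀ i → ∃[ v ] a ≡ v ℕ.* g i × v ℕ.∣ ∣ add i ∣
        cofactor i = cofactor∣ a ∣ diff i ∣ ∣ add i ∣ (subst (a ℕ.∣_)
          (trans (cong ∣_∣ (difference-of-squares (k h (point i)) (k h b₀))) (abs-* (diff i) (add i)))
          (∣⇒∣ᵤ (x₀∣X (point∈ i) b₀∈)))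

      collision : ∃[ i ] ∃[ i′ ] i Fin.< i′ × Any.index (g∈ i) ≡ Any.index (g∈ i′) → x₀ ∈ products (2 ℕ.* N)
      collision (i , i′ , i<i′ , index≡) =
        ∈-products {2 ℕ.* N} x₀ {l} {g i} {v} l≢0 (∣k-k∣≤ (point∈ i) (point∈ i′)) u∣l v∣l (trans a≡ (ℕ.*-comm v (g i)))
        where
        κ = k h (point i)
        κ′ = k h (point i′)
        κ₀ = k h b₀
        l = ∣ κ - κ′ ∣
        g≡ : g i ≡ g i′
        g≡ = trans (lookup-index (g∈ i)) (trans (cong (lookup (divisors a)) index≡) (sym (lookup-index (g∈ i′))))
        v = proj₁ (cofactor i)
        a≡ : a ≡ v ℕ.* g i
        a≡ = proj₁ (proj₂ (cofactor i))
        g-nonZero : NonZero (g i)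
        g-nonZero = ≢-nonZero (λ g≡0 → ≢-nonZero⁻¹ a (trans a≡ (trans (cong (v ℕ.*_) g≡0) (ℕ.*-zeroʳ v))))
        v≡ : proj₁ (cofactor i′) ≡ v
        v≡ = ℕ.*-cancelʳ-≡ _ v (g i) {{g-nonZero}} (trans (cong (proj₁ (cofactor i′) ℕ.*_) g≡) (trans (sym (proj₁ (proj₂ (cofactor i′)))) a≡))
        l≢0 : l ≢ 0
        l≢0 l≡0 = ℕ.<⇒≢ i<i′ (cong toℕ (lookup-injective (UU-unique h)
          (k-injective (point∈ i) (point∈ i′) (ℤ.i-j≡0⇒i≡j κ κ′ (∣i∣≡0⇒i≡0 l≡0)))))
        u∣l : g i ℕ.∣ l
        u∣l = ∣⇒∣ᵤ (subst (+ g i ∣_) (identity κ κ′ κ₀) (∣m∣n⇒∣m-n {m = diff i} {diff i′} (∣ᵤ⇒∣ (gcd[m,n]∣n a ∣ diff i ∣))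
          (∣ᵤ⇒∣ (subst (ℕ._∣ ∣ diff i′ ∣) (sym g≡) (gcd[m,n]∣n a ∣ diff i′ ∣)))))
          where
          identity : ∀ k k′ c → (k - c) - (k′ - c) ≡ k - k′
          identity = solve-∀
        v∣l : v ℕ.∣ l
        v∣l = ∣⇒∣ᵤ (subst (+ v ∣_) (identity κ κ′ κ₀) (∣m∣n⇒∣m-n {m = add i} {add i′} (∣ᵤ⇒∣ (proj₂ (proj₂ (cofactor i))))
          (∣ᵤ⇒∣ (subst (ℕ._∣ ∣ add i′ ∣) v≡ (proj₂ (proj₂ (cofactor i′)))))))
          where
          identity : ∀ k k′ c → (k + c) - (k′ + c) ≡ k - k′
          identity = solve-∀

      x₀∈products : x₀ ∈ products (2 ℕ.* N)
      x₀∈products = collision (pigeonhole τ<r (Any.index ∘ g∈))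

    -- `products` does not mention h, which allows all structured h to be counted at once; y₀ serves
    -- to make t a divisor of `Y`.
    Structured : Set
    Structured = ∃[ x₀ ] ∃[ y₀ ] x₀ ∈ products (2 ℕ.* N) × y₀ ≢ 0ℤ × (x₀ , y₀) ∈L ×
      (∀ {b b′} → InUU h b → InUU h b′ → ∃[ t ] X h b b′ ≡ t * x₀ × Y h b b′ ≡ t * y₀)

    -- The pigeonhole applies: τ(∣x₀∣) ≤ D < r because ∣x₀∣ ≤ 2N² ≤ 8N³, and x₀ = 0 would give q ∣
    -- 2h² y₀ with 0 < ∣y₀∣ ≤ 4N < q.
    collinear⇒structured : D ℕ.< r → Collinear → Structured
    collinear⇒structured D<r (x₀ , y₀ , y₀≢0 , v₀∈L , x₀≤ , y₀≤ , multiple) =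
      x₀ , y₀ , x₀∈products x₀≢0 (ℕ.≤-<-trans τ∣x₀∣≤D D<r) (λ p p′ → let t , X≡ , _ = multiples′ p p′ in divides t X≡) ,
      y₀≢0 , v₀∈L , multiples′
      where
      multiples′ : ∀ {b b′} → InUU h b → InUU h b′ → ∃[ t ] X h b b′ ≡ t * x₀ × Y h b b′ ≡ t * y₀
      multiples′ p p′ = multiple (∣X∣≤ p p′) (∣Y∣≤ p p′) (J*X≈ p p′)
      x₀≢0 : x₀ ≢ 0ℤ
      x₀≢0 refl = y₀≢0 (∣z⇒≡0 (prime∣*-cancelˡ pq (+ 2 * (H * H)) y₀ q∤2H²
        (combine (∣m⇒∣-m v₀∈L) (∣n⇒∣m*n J (divides (+ 0) refl)) (identity (J * 0ℤ) (+ 2 * (H * H) * y₀))))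
        (small (ℕ.≤-trans y₀≤ (ℕ.*-monoˡ-≤ N (ℕ.m≤m+n 4 4)))))
        where
        identity : ∀ a b → b ≡ - (a - b) + a
        identity = solve-∀
      τ∣x₀∣≤D : τ ∣ x₀ ∣ ℕ.≤ D
      τ∣x₀∣≤D = τ≤D (ℕ.≤-trans x₀≤ (ℕ.*-mono-≤ (ℕ.m≤m+n 2 6) (ℕ.m≤m*n (N ℕ.* N) N)))

    small-or-structured : Small ⊎ Structured
    small-or-structured = [ inj₁ ∘ few⇒small , (λ collinear → alternative collinear (r ℕ.≤? D)) ]′ few-or-collinear
      where
      alternative : Collinear → Dec (r ℕ.≤ D) → Small ⊎ Structured
      alternative _ (yes r≤D) = inj₁ (r≤D⇒small r≤D)
      alternative collinear (no r≰D) = inj₂ (collinear⇒structured (ℕ.≰⇒> r≰D) collinear)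

  length-take≤ : ∀ {A : Set} n (xs : List A) → length (take n xs) ℕ.≤ n
  length-take≤ n xs = ℕ.≤-trans (ℕ.≤-reflexive (length-take n xs)) (ℕ.m⊓n≤m n (length xs))

  ∈-take : ∀ {A : Set} {x : A} {n xs} → length xs ℕ.≤ n → x ∈ xs → x ∈ take n xs
  ∈-take {x = x} {n} {xs} len≤ = subst (x ∈_) (sym (take-all n xs len≤))

  ∈-bools : ∀ σ → σ ∈ true ∷ false ∷ []
  ∈-bools true = here refl
  ∈-bools false = there (here refl)

  -- Counting all quadruples

  module Quadruples (q : ℕ) .{{_ : NonZero q}} (pq : Prime q) (j : Fin q) (j≢0 : j ≢ Residues.⟦_⟧ q 0)
                    (N : ℕ) .{{_ : NonZero N}}
                    (D : ℕ) (τ≤D : ∀ {n} → n ℕ.≤ 8 ℕ.* (N ℕ.* N ℕ.* N) → τ n ℕ.≤ D)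
                    (B : ℕ) (≤B : ∀ r → r ℕ.* r ℕ.* q ℕ.≤ 289 ℕ.* (D ℕ.* D) ℕ.* (N ℕ.* N ℕ.* N ℕ.+ q) → r ℕ.≤ B) where

    open Residues q
    open Energy q pq j j≢0 N

    -- Tells h from - h.
    lower : 𝔽 → Bool
    lower b = does (toℕ b ℕ.+ toℕ b ℕ.<? q)

    opposite-lower : ∀ {a b} → toℕ a ℕ.+ toℕ b ≡ q → toℕ a ℕ.< toℕ b → lower a ≢ lower b
    opposite-lower {a} {b} sum≡q a<b lower≡ with () ← trans (sym (dec-true (toℕ a ℕ.+ toℕ a ℕ.<? q) (subst (toℕ a ℕ.+ toℕ a ℕ.<_) sum≡q (ℕ.+-monoʳ-< (toℕ a) a<b))))
      (trans lower≡ (dec-false (toℕ b ℕ.+ toℕ b ℕ.<? q) (ℕ.<⇒≯ (subst (ℕ._< toℕ b ℕ.+ toℕ b) sum≡q (ℕ.+-monoˡ-< (toℕ b) a<b)))))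

    -- Besides a = b there is only q ∣ a + b, so the representatives sum to 0 or q. If they differ
    -- and sum to q, one lies below q/2 and the other above, so `lower` separates them.
    square-injective : ∀ {a b} → ⌊ a ⌋ * ⌊ a ⌋ ≈ ⌊ b ⌋ * ⌊ b ⌋ → lower a ≡ lower b → a ≡ b
    square-injective {a} {b} a²≈b² lower≡ = [ ⌊⌋-injective , opposite ∘ ∣⇒∣ᵤ ]′
      (prime∣* pq (⌊ a ⌋ - ⌊ b ⌋) (⌊ a ⌋ + ⌊ b ⌋) (subst (+ q ∣_) (difference-of-squares ⌊ a ⌋ ⌊ b ⌋) a²≈b²))
      where
      opposite : q ℕ.∣ toℕ a ℕ.+ toℕ b → a ≡ b
      opposite (ℕ.divides 0 sum≡0) = toℕ-injective (trans (ℕ.m+n≡0⇒m≡0 (toℕ a) sum≡0) (sym (ℕ.m+n≡0⇒n≡0 (toℕ a) sum≡0)))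
      opposite (ℕ.divides 1 sum≡q) with ℕ.<-cmp (toℕ a) (toℕ b)
      ... | tri< a<b _ _ = contradiction lower≡ (opposite-lower (trans sum≡q (ℕ.*-identityˡ q)) a<b)
      ... | tri≈ _ a≡b _ = toℕ-injective a≡b
      ... | tri> _ _ b<a = contradiction (sym lower≡) (opposite-lower (trans (ℕ.+-comm (toℕ b) (toℕ a)) (trans sum≡q (ℕ.*-identityˡ q))) b<a)
      opposite (ℕ.divides (suc (suc c)) sum≡) = contradiction (ℕ.+-mono-< (toℕ<n a) (toℕ<n b))
        (ℕ.≤⇒≯ (subst (q ℕ.+ q ℕ.≤_) (sym sum≡) (ℕ.+-monoʳ-≤ q (ℕ.m≤m+n q (c ℕ.* q)))))

    U : List 𝔽
    U = filter inU? (allFin q)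

    ∈-U : ∀ {b} → InU b → b ∈ U
    ∈-U {b} = ∈-filter⁺ inU? (∈-allFin b)

    4N : ℕ
    4N = 4 ℕ.* N

    -- Each n j has at most two square roots, told apart by `lower`. Indices are taken from [0, N],
    -- and 2(N + 1) ≤ 4N.
    atMost-U : AtMost 4N InU
    atMost-U xs u us = ℕ.≤-trans
      (atMost-coded {R = Root} root-injective codes xs u (All.map (λ {b} b∈ → (ind b , lower b) , ∈-pairs {f = λ _ → true ∷ false ∷ []} (∈-upTo⁺ (s≤s (ind≤ b∈))) (∈-bools (lower b)) , b∈ , refl , refl) us))
      (begin
        length codes                             ≤⟨ length-pairs (upTo (suc N)) {λ _ → true ∷ false ∷ []} (λ _ → ℕ.≤-refl) ⟩
        length (upTo (suc N)) ℕ.* 2              ≡⟨ cong (ℕ._* 2) (length-upTo (suc N)) ⟩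
        suc N ℕ.* 2                              ≤⟨ ℕ.*-monoˡ-≤ 2 (ℕ.+-monoˡ-≤ N (ℕ.>-nonZero⁻¹ N)) ⟩
        (N ℕ.+ N) ℕ.* 2                          ≡⟨ identity N ⟩
        4N                                       ∎)
      where
      open ℕ.≤-Reasoning
      identity : ∀ N → (N ℕ.+ N) ℕ.* 2 ≡ 4 ℕ.* N
      identity = solve-∀ℕ
      codes : List (ℕ × Bool)
      codes = pairs (upTo (suc N)) (λ _ → true ∷ false ∷ [])
      Root : 𝔽 → ℕ × Bool → Set
      Root b (n , σ) = InU b × ind b ≡ n × lower b ≡ σ
      root-injective : ∀ b c nσ → Root b nσ → Root c nσ → b ≡ c
      root-injective b c _ (b∈ , refl , refl) (c∈ , n≡ , σ≡) = square-injective
        (combine (ind-square b b∈) (∣m⇒∣-m (subst (λ n → ⌊ c ⌋ * ⌊ c ⌋ ≈ + n * J) n≡ (ind-square c c∈))) (id₁ (⌊ b ⌋ * ⌊ b ⌋) (⌊ c ⌋ * ⌊ c ⌋) (+ ind b * J)))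
        (sym σ≡)
        where
        id₁ : ∀ x y z → x - y ≡ (x - z) + - (y - z)
        id₁ = solve-∀

    ∣U∣≤ : length U ℕ.≤ 4N
    ∣U∣≤ = atMost-U U (Unique.filter⁺ inU? (Unique.allFin⁺ q)) (All.tabulate (proj₂ ∘ ∈-filter⁻ inU? {xs = allFin q}))

    ∣UU∣≤ : ∀ h → length (UU h) ℕ.≤ 4N
    ∣UU∣≤ h = atMost-U (UU h) (UU-unique h) (All.tabulate (proj₁ ∘ ∈-UU⁻ {h}))

    parallelogram : 𝔽 → 𝔽 → 𝔽 → Quadruple
    parallelogram h b b′ = b ⊕ h , b′ , b , b′ ⊕ h

    -- The last equation recovers h from the entries b ⊕ h and b, so that codes can store a pair
    -- from `U` in place of h.
    Parallelogram : Quadruple → Set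
    Parallelogram x = ∃[ h ] ∃[ b ] ∃[ b′ ] InUU h b × InUU h b′ × x ≡ parallelogram h b b′ × h ≡ b ⊕ h ⊖ b

    counted⇒parallelogram : ∀ {x} → Counted j N x → Parallelogram x
    counted⇒parallelogram {b₁ , b₂ , b₃ , b₄} (sum≡ , b₁∈ , b₂∈ , b₃∈ , b₄∈) =
      h , b₃ , b₂ , (b₃∈ , subst InU b₁≡ b₁∈) , (b₂∈ , subst InU b₄≡ b₄∈) ,
      cong₂ (λ u v → u , b₂ , b₃ , v) b₁≡ b₄≡ , cong (_⊖ b₃) b₁≡
      where
      h = b₁ ⊖ b₃
      b₁≡ : b₁ ≡ b₃ ⊕ h
      b₁≡ = ⌊⌋-injective (combine (∣m⇒∣-m (⌊⊕⌋ b₃ h)) (∣m⇒∣-m (⌊⊖⌋ b₁ b₃)) (identity ⌊ b₁ ⌋ ⌊ b₃ ⌋ ⌊ h ⌋ ⌊ b₃ ⊕ h ⌋))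
        where
        identity : ∀ b₁ b₃ h c → b₁ - c ≡ - (c - (b₃ + h)) + - (h - (b₁ - b₃))
        identity = solve-∀
      sum≈ : ⌊ b₁ ⌋ + ⌊ b₂ ⌋ ≈ ⌊ b₃ ⌋ + ⌊ b₄ ⌋
      sum≈ = combine (∣m⇒∣-m (⌊⊕⌋ b₁ b₂)) (subst (λ z → ⌊ z ⌋ ≈ ⌊ b₃ ⌋ + ⌊ b₄ ⌋) (sym sum≡) (⌊⊕⌋ b₃ b₄))
        (identity (⌊ b₁ ⌋ + ⌊ b₂ ⌋) (⌊ b₃ ⌋ + ⌊ b₄ ⌋) ⌊ b₁ ⊕ b₂ ⌋)
        where
        identity : ∀ a b c → a - b ≡ - (c - a) + (c - b)
        identity = solve-∀
      b₄≡ : b₄ ≡ b₂ ⊕ h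
      b₄≡ = ⌊⌋-injective (combine (∣m⇒∣-m (⌊⊕⌋ b₂ h)) (combine (∣m⇒∣-m (⌊⊖⌋ b₁ b₃)) (∣m⇒∣-m sum≈) refl)
        (identity ⌊ b₁ ⌋ ⌊ b₂ ⌋ ⌊ b₃ ⌋ ⌊ b₄ ⌋ ⌊ h ⌋ ⌊ b₂ ⊕ h ⌋))
        where
        identity : ∀ b₁ b₂ b₃ b₄ h c → b₄ - c ≡ - (c - (b₂ + h)) + (- (h - (b₁ - b₃)) + - (b₁ + b₂ - (b₃ + b₄)))
        identity = solve-∀

    -- The pair (c, b) from `U` × `U` stands for h = c - b together with b, which is the bound Σ
    -- r(h) ≤ ∣U∣²; then b′ is one of at most B elements.
    SmallCode : Quadruple → 𝔽 × 𝔽 × 𝔽 → Set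
    SmallCode x (c , b , b′) = x ≡ parallelogram (c ⊖ b) b b′

    -- Truncating with take bounds the length of the list without a case distinction on h.
    smallCodes : List (𝔽 × 𝔽 × 𝔽)
    smallCodes = pairs U (λ c → pairs U (λ b → take B (UU (c ⊖ b))))

    atMost-small : AtMost (4N ℕ.* (4N ℕ.* B)) (Coded SmallCode smallCodes)
    atMost-small xs u ps = ℕ.≤-trans (atMost-coded {R = SmallCode} (λ { _ _ _ refl refl → refl }) smallCodes xs u ps)
      (ℕ.≤-trans (length-pairs U {λ c → pairs U (λ b → take B (UU (c ⊖ b)))} (λ {c} _ → inner c)) (ℕ.*-monoˡ-≤ (4N ℕ.* B) ∣U∣≤))
      where
      inner : ∀ c → length (pairs U (λ b → take B (UU (c ⊖ b)))) ℕ.≤ 4N ℕ.* B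
      inner c = ℕ.≤-trans (length-pairs U {λ b → take B (UU (c ⊖ b))} (λ {b} _ → length-take≤ B (UU (c ⊖ b)))) (ℕ.*-monoˡ-≤ B ∣U∣≤)

    small-coded : ∀ {h b b′} → InUU h b → InUU h b′ → h ≡ b ⊕ h ⊖ b → length (UU h) ℕ.≤ B →
                  Coded SmallCode smallCodes (parallelogram h b b′)
    small-coded {h} {b} {b′} p@(b∈ , b+h∈) p′ h≡ r≤B = (b ⊕ h , b , b′) ,
      ∈-pairs {f = λ c → pairs U (λ a → take B (UU (c ⊖ a)))} (∈-U b+h∈)
        (∈-pairs {f = λ a → take B (UU (b ⊕ h ⊖ a))} (∈-U b∈) (subst (λ h′ → b′ ∈ take B (UU h′)) h≡ (∈-take r≤B (∈-UU⁺ p′)))) ,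
      cong (λ h′ → parallelogram h′ b b′) h≡

    -- For h = 0 the relation j k = h (2b + h) no longer determines b, but there are only ∣U∣² such
    -- quadruples.
    ZeroCode : Quadruple → 𝔽 × 𝔽 → Set
    ZeroCode x (b , b′) = x ≡ parallelogram ⟦ 0 ⟧ b b′

    zeroCodes : List (𝔽 × 𝔽)
    zeroCodes = pairs U (λ _ → U)

    atMost-zero : AtMost (4N ℕ.* 4N) (Coded ZeroCode zeroCodes)
    atMost-zero xs u ps = ℕ.≤-trans (atMost-coded {R = ZeroCode} (λ { _ _ _ refl refl → refl }) zeroCodes xs u ps)
      (ℕ.≤-trans (length-pairs U {λ _ → U} (λ _ → ∣U∣≤)) (ℕ.*-monoˡ-≤ 4N ∣U∣≤))

    module _ (8N<q : 8 ℕ.* N ℕ.< q) where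

      private
        module F = Fibre q pq j j≢0 N 8N<q D τ≤D

      -- b′ stays existential: the sign fixes its k, and k is injective on the fibre.
      EqualCode : Quadruple → 𝔽 × 𝔽 × Bool → Set
      EqualCode x (c , b , σ) = ∃[ b′ ] c ⊖ b ≢ ⟦ 0 ⟧ × InUU (c ⊖ b) b′ × x ≡ parallelogram (c ⊖ b) b b′ ×
        k (c ⊖ b) b′ ≡ (if σ then k (c ⊖ b) b else - k (c ⊖ b) b)

      equalCodes : List (𝔽 × 𝔽 × Bool)
      equalCodes = pairs U (λ _ → pairs U (λ _ → true ∷ false ∷ []))

      atMost-equal : AtMost (4N ℕ.* (4N ℕ.* 2)) (Coded EqualCode equalCodes)
      atMost-equal xs u ps = ℕ.≤-trans (atMost-coded {R = EqualCode} injective equalCodes xs u ps)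
        (ℕ.≤-trans (length-pairs U {λ _ → pairs U (λ _ → true ∷ false ∷ [])} (λ _ → length-pairs U {λ _ → true ∷ false ∷ []} (λ _ → ℕ.≤-refl)))
          (ℕ.*-mono-≤ ∣U∣≤ (ℕ.*-monoˡ-≤ 2 ∣U∣≤)))
        where
        injective : ∀ x y c → EqualCode x c → EqualCode y c → x ≡ y
        injective _ _ (c , b , σ) (b′ , h≢0 , p , x≡ , k≡) (a′ , _ , p′ , y≡ , k≡′) =
          trans x≡ (trans (cong (parallelogram (c ⊖ b) b) (F.k-injective (c ⊖ b) h≢0 p p′ (trans k≡ (sym k≡′)))) (sym y≡))

      equal-coded : ∀ {h b b′} (h≢0 : h ≢ ⟦ 0 ⟧) → InUU h b → InUU h b′ → h ≡ b ⊕ h ⊖ b → F.Equal h h≢0 b b′ →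
                    Coded EqualCode equalCodes (parallelogram h b b′)
      equal-coded {h} {b} {b′} h≢0 (b∈ , b+h∈) p′ h≡ = [ withSign true , withSign false ]′
        where
        withSign : ∀ σ → k h b′ ≡ (if σ then k h b else - k h b) → Coded EqualCode equalCodes (parallelogram h b b′)
        withSign σ k≡ = (b ⊕ h , b , σ) ,
          ∈-pairs {f = λ _ → pairs U (λ _ → true ∷ false ∷ [])} (∈-U b+h∈) (∈-pairs {f = λ _ → true ∷ false ∷ []} (∈-U b∈) (∈-bools σ)) ,
          b′ , subst (λ h′ → h′ ≢ ⟦ 0 ⟧ × InUU h′ b′ × parallelogram h b b′ ≡ parallelogram h′ b b′ × k h′ b′ ≡ (if σ then k h′ b else - k h′ b))
                     h≡ (h≢0 , p′ , refl , k≡)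

      -- h is existential as well: y and x = t x₀ determine h², σ selects the root, and d with x
      -- determines k and k′.
      StructuredCode : Quadruple → ℤ × ℤ × ℤ × ℤ × Bool → Set
      StructuredCode x (y , t , x₀ , d , σ) = ∃[ h ] ∃[ b ] ∃[ b′ ] h ≢ ⟦ 0 ⟧ × InUU h b × InUU h b′ × x ≡ parallelogram h b b′ ×
        Y h b b′ ≡ y × X h b b′ ≡ t * x₀ × k h b - k h b′ ≡ d × d ≢ 0ℤ × y ≢ 0ℤ × lower h ≡ σ

      -- For t and x₀ that occur, t x₀ is a nonzero `X` of size at most N² with at most 2D signed
      -- divisors, so the truncation loses none of them.
      dCodes : ℤ → ℤ → List (ℤ × Bool)
      dCodes t x₀ = pairs (take (2 ℕ.* D) (signedDivisors (t * x₀))) (λ _ → true ∷ false ∷ [])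

      x₀Codes : ℤ → List (ℤ × ℤ × Bool)
      x₀Codes t = pairs (products (2 ℕ.* N)) (dCodes t)

      tCodes : ℤ → List (ℤ × ℤ × ℤ × Bool)
      tCodes y = pairs (take (2 ℕ.* D) (signedDivisors y)) x₀Codes

      structuredCodes : List (ℤ × ℤ × ℤ × ℤ × Bool)
      structuredCodes = pairs (range (2 ℕ.* N)) tCodes

      -- 5N values of y, 2D of t, 4N D² of x₀, 2D of d, and two of σ.
      ∣structuredCodes∣≤ : length structuredCodes ℕ.≤ 160 ℕ.* (N ℕ.* N) ℕ.* (D ℕ.* D ℕ.* (D ℕ.* D))
      ∣structuredCodes∣≤ = begin
        length structuredCodes                                                       ≤⟨ length-pairs (range (2 ℕ.* N)) {tCodes} (λ {y} _ → t≤ y) ⟩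
        length (range (2 ℕ.* N)) ℕ.* (2 ℕ.* D ℕ.* (2 ℕ.* (2 ℕ.* N ℕ.* (D ℕ.* D)) ℕ.* (2 ℕ.* D ℕ.* 2))) ≤⟨ ℕ.*-monoˡ-≤ _ range≤ ⟩
        5 ℕ.* N ℕ.* (2 ℕ.* D ℕ.* (2 ℕ.* (2 ℕ.* N ℕ.* (D ℕ.* D)) ℕ.* (2 ℕ.* D ℕ.* 2))) ≡⟨ identity N D ⟩
        160 ℕ.* (N ℕ.* N) ℕ.* (D ℕ.* D ℕ.* (D ℕ.* D))                                ∎
        where
        open ℕ.≤-Reasoning
        identity : ∀ N D → 5 ℕ.* N ℕ.* (2 ℕ.* D ℕ.* (2 ℕ.* (2 ℕ.* N ℕ.* (D ℕ.* D)) ℕ.* (2 ℕ.* D ℕ.* 2))) ≡ 160 ℕ.* (N ℕ.* N) ℕ.* (D ℕ.* D ℕ.* (D ℕ.* D))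
        identity = solve-∀ℕ
        range≤ : length (range (2 ℕ.* N)) ℕ.≤ 5 ℕ.* N
        range≤ = begin
          length (range (2 ℕ.* N))           ≡⟨ length-range (2 ℕ.* N) ⟩
          1 ℕ.+ (2 ℕ.* N ℕ.+ 2 ℕ.* N)        ≤⟨ ℕ.+-monoˡ-≤ (2 ℕ.* N ℕ.+ 2 ℕ.* N) (ℕ.>-nonZero⁻¹ N) ⟩
          N ℕ.+ (2 ℕ.* N ℕ.+ 2 ℕ.* N)        ≡⟨ id₁ N ⟩
          5 ℕ.* N                            ∎
          where
          id₁ : ∀ N → N ℕ.+ (2 ℕ.* N ℕ.+ 2 ℕ.* N) ≡ 5 ℕ.* N
          id₁ = solve-∀ℕ
        d≤ : ∀ t x₀ → length (dCodes t x₀) ℕ.≤ 2 ℕ.* D ℕ.* 2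
        d≤ t x₀ = ℕ.≤-trans (length-pairs (take (2 ℕ.* D) (signedDivisors (t * x₀))) {λ _ → true ∷ false ∷ []} (λ _ → ℕ.≤-refl))
                            (ℕ.*-monoˡ-≤ 2 (length-take≤ (2 ℕ.* D) (signedDivisors (t * x₀))))
        2N≤8N³ : 2 ℕ.* N ℕ.≤ 8 ℕ.* (N ℕ.* N ℕ.* N)
        2N≤8N³ = ℕ.*-mono-≤ (ℕ.m≤m+n 2 6) (ℕ.m≤n*m N (N ℕ.* N) {{ℕ.m*n≢0 N N}})
        x₀≤ : ∀ t → length (x₀Codes t) ℕ.≤ 2 ℕ.* (2 ℕ.* N ℕ.* (D ℕ.* D)) ℕ.* (2 ℕ.* D ℕ.* 2)
        x₀≤ t = ℕ.≤-trans (length-pairs (products (2 ℕ.* N)) {dCodes t} (λ {x₀} _ → d≤ t x₀))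
                          (ℕ.*-monoˡ-≤ (2 ℕ.* D ℕ.* 2) (length-products {2 ℕ.* N} {D} (λ n≤ → τ≤D (ℕ.≤-trans n≤ 2N≤8N³))))
        t≤ : ∀ y → length (tCodes y) ℕ.≤ 2 ℕ.* D ℕ.* (2 ℕ.* (2 ℕ.* N ℕ.* (D ℕ.* D)) ℕ.* (2 ℕ.* D ℕ.* 2))
        t≤ y = ℕ.≤-trans (length-pairs (take (2 ℕ.* D) (signedDivisors y)) {x₀Codes} (λ {t} _ → x₀≤ t))
                         (ℕ.*-monoˡ-≤ _ (length-take≤ (2 ℕ.* D) (signedDivisors y)))

      -- Subtracting the two lattice relations gives q ∣ 2y (h² - h₁²), where q divides neither 2
      -- nor y, as 0 < ∣y∣ ≤ 2N < q. Once h = h₁, the pair (k, k′) is recovered from d and x.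
      structured-injective : ∀ x y c → StructuredCode x c → StructuredCode y c → x ≡ y
      structured-injective _ _ (y , t , x₀ , d , σ) (h , b , b′ , h≢0 , p , p′ , refl , Y≡ , X≡ , d≡ , d≢0 , y≢0 , σ≡)
                                                    (h₁ , c , c′ , _ , o , o′ , refl , Y₁≡ , X₁≡ , d₁≡ , _ , _ , σ₁≡) = same h≡
        where
        q∤y : ¬ (+ q ∣ y)
        q∤y q∣y = y≢0 (∣z⇒≡0 q∣y (ℕ.≤-<-trans (subst (λ z → ∣ z ∣ ℕ.≤ 2 ℕ.* N) Y≡ (∣Y∣≤ p p′)) (F.2N<q h h≢0)))
        H²≈ : ⌊ h ⌋ * ⌊ h ⌋ ≈ ⌊ h₁ ⌋ * ⌊ h₁ ⌋
        H²≈ = prime∣*-cancelˡ pq y _ q∤y (prime∣*-cancelˡ pq (+ 2) (y * (⌊ h ⌋ * ⌊ h ⌋ - ⌊ h₁ ⌋ * ⌊ h₁ ⌋)) (F.q∤2 h h≢0)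
          (combine (subst₂ (λ x y → J * x ≈ + 2 * (⌊ h₁ ⌋ * ⌊ h₁ ⌋) * y) X₁≡ Y₁≡ (J*X≈ o o′))
                   (∣m⇒∣-m (subst₂ (λ x y → J * x ≈ + 2 * (⌊ h ⌋ * ⌊ h ⌋) * y) X≡ Y≡ (J*X≈ p p′)))
                   (identity (J * (t * x₀)) (⌊ h ⌋ * ⌊ h ⌋) (⌊ h₁ ⌋ * ⌊ h₁ ⌋) y)))
          where
          identity : ∀ a u v y → + 2 * (y * (u - v)) ≡ (a - + 2 * v * y) + - (a - + 2 * u * y)
          identity = solve-∀
        h≡ : h ≡ h₁
        h≡ = square-injective H²≈ (trans σ≡ (sym σ₁≡))
        same : h ≡ h₁ → parallelogram h b b′ ≡ parallelogram h₁ c c′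
        same refl =
          let k≡ , k′≡ = pair-determined (k h b) (k h b′) (k h c) (k h c′) (λ eq → d≢0 (trans (sym d≡) eq)) (trans d≡ (sym d₁≡)) (trans X≡ (sym X₁≡))
          in cong₂ (parallelogram h) (F.k-injective h h≢0 p o k≡) (F.k-injective h h≢0 p′ o′ k′≡)

      atMost-structured : AtMost (160 ℕ.* (N ℕ.* N) ℕ.* (D ℕ.* D ℕ.* (D ℕ.* D))) (Coded StructuredCode structuredCodes)
      atMost-structured xs u ps = ℕ.≤-trans (atMost-coded {R = StructuredCode} structured-injective structuredCodes xs u ps) ∣structuredCodes∣≤

      divisor∈ : ∀ {d z} → z ≢ 0ℤ → d ∣ z → ∣ z ∣ ℕ.≤ 8 ℕ.* (N ℕ.* N ℕ.* N) → d ∈ take (2 ℕ.* D) (signedDivisors z)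
      divisor∈ {d} {z} z≢0 d∣z z≤ = ∈-take (ℕ.≤-trans (ℕ.≤-reflexive (length-signed (divisors ∣ z ∣))) (ℕ.*-monoʳ-≤ 2 (τ≤D z≤))) (∈-signedDivisors z≢0 d∣z)

      structured-coded : ∀ {h b b′} (h≢0 : h ≢ ⟦ 0 ⟧) → InUU h b → InUU h b′ → F.Structured h h≢0 →
                         Y h b b′ ≢ 0ℤ → k h b - k h b′ ≢ 0ℤ → Coded StructuredCode structuredCodes (parallelogram h b b′)
      structured-coded {h} {b} {b′} h≢0 p p′ (x₀ , y₀ , x₀∈ , _ , _ , multiple) Y≢0 d≢0 =
        (Y h b b′ , t , x₀ , d , lower h) ,
        ∈-pairs {f = tCodes} (∈-range⁺ (Y h b b′) (∣Y∣≤ p p′))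
          (∈-pairs {f = x₀Codes} (divisor∈ Y≢0 (divides y₀ (trans Y≡ (ℤ.*-comm t y₀))) Y≤)
            (∈-pairs {f = dCodes t} x₀∈
              (∈-pairs {f = λ _ → true ∷ false ∷ []} d∈ (∈-bools (lower h))))) ,
        h , b , b′ , h≢0 , p , p′ , refl , refl , X≡ , refl , d≢0 , Y≢0 , refl
        where
        t : ℤ
        t = proj₁ (multiple p p′)
        X≡ : X h b b′ ≡ t * x₀
        X≡ = proj₁ (proj₂ (multiple p p′))
        Y≡ : Y h b b′ ≡ t * y₀
        Y≡ = proj₂ (proj₂ (multiple p p′))
        d : ℤ
        d = k h b - k h b′
        Y≤ : ∣ Y h b b′ ∣ ℕ.≤ 8 ℕ.* (N ℕ.* N ℕ.* N)
        Y≤ = ℕ.≤-trans (∣Y∣≤ p p′) (ℕ.*-mono-≤ (ℕ.m≤m+n 2 6) (ℕ.m≤n*m N (N ℕ.* N) {{ℕ.m*n≢0 N N}}))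
        d∈ : d ∈ take (2 ℕ.* D) (signedDivisors (t * x₀))
        d∈ = subst (λ z → d ∈ take (2 ℕ.* D) (signedDivisors z)) X≡
          (divisor∈ (F.X≢0 h h≢0 p p′ Y≢0) (divides (k h b + k h b′) (trans (difference-of-squares (k h b) (k h b′)) (ℤ.*-comm d (k h b + k h b′))))
            (ℕ.≤-trans (∣X∣≤ p p′) (ℕ.≤-trans (ℕ.m≤m*n (N ℕ.* N) N) (ℕ.m≤n*m (N ℕ.* N ℕ.* N) 8))))

      -- A fibre with more than B points and h ≠ 0 violates the maximality of B if it is small, so
      -- it is structured, and each of its pairs is exceptional or has `Y` ≠ 0.
      parallelogram-coded : ∀ {h b b′} → InUU h b → InUU h b′ → h ≡ b ⊕ h ⊖ b → Dec (length (UU h) ℕ.≤ B) → Dec (h ≡ ⟦ 0 ⟧) →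
        let x = parallelogram h b b′ in
        Coded SmallCode smallCodes x ⊎ Coded ZeroCode zeroCodes x ⊎ Coded EqualCode equalCodes x ⊎ Coded StructuredCode structuredCodes x
      parallelogram-coded p p′ h≡ (yes r≤B) _ = inj₁ (small-coded p p′ h≡ r≤B)
      parallelogram-coded {h} {b} {b′} (b∈ , _) (b′∈ , _) _ (no _) (yes refl) = inj₂ (inj₁ ((b , b′) , ∈-pairs {f = λ _ → U} (∈-U b∈) (∈-U b′∈) , refl))
      parallelogram-coded {h} p p′ h≡ (no r≰B) (no h≢0) = inj₂ (inj₂
        ([ (λ small → contradiction (≤B (length (UU h)) small) r≰B)
         , (λ structured → Sum.map (equal-coded h≢0 p p′ h≡) (λ (Y≢0 , d≢0) → structured-coded h≢0 p p′ structured Y≢0 d≢0) (F.equal-or-Y≢0 h h≢0 p p′)) ]′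
         (F.small-or-structured h h≢0)))

    1≤D : 1 ℕ.≤ D
    1≤D = divisor-bound≥1 N τ≤D

    -- Here r² q ≤ (4N)² · 8N = 128 N³, below the threshold that defines B.
    small-q : q ℕ.≤ 8 ℕ.* N → ∀ h → length (UU h) ℕ.≤ B
    small-q q≤8N h = ≤B r (begin
      r ℕ.* r ℕ.* q                                ≤⟨ ℕ.*-mono-≤ (ℕ.*-mono-≤ (∣UU∣≤ h) (∣UU∣≤ h)) q≤8N ⟩
      4 ℕ.* N ℕ.* (4 ℕ.* N) ℕ.* (8 ℕ.* N)          ≡⟨ identity N ⟩
      128 ℕ.* (N ℕ.* N ℕ.* N)                      ≤⟨ ℕ.*-mono-≤ (ℕ.≤-trans (ℕ.m≤m+n 128 161) (ℕ.m≤m*n 289 (D ℕ.* D) {{ℕ.m*n≢0 D D}})) (ℕ.m≤m+n (N ℕ.* N ℕ.* N) q) ⟩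
      289 ℕ.* (D ℕ.* D) ℕ.* (N ℕ.* N ℕ.* N ℕ.+ q)  ∎)
      where
      open ℕ.≤-Reasoning
      instance
        D-nonZero : NonZero D
        D-nonZero = >-nonZero 1≤D
      r = length (UU h)
      identity : ∀ N → 4 ℕ.* N ℕ.* (4 ℕ.* N) ℕ.* (8 ℕ.* N) ≡ 128 ℕ.* (N ℕ.* N ℕ.* N)
      identity = solve-∀ℕ

    quadruples-unique : Unique quadruples
    quadruples-unique = Unique.cartesianProduct⁺ (Unique.allFin⁺ q) (Unique.cartesianProduct⁺ (Unique.allFin⁺ q)
      (Unique.cartesianProduct⁺ (Unique.allFin⁺ q) (Unique.allFin⁺ q)))

    T₂₂≤ : ∀ {M} → AtMost M Parallelogram → T₂₂ j N ℕ.≤ M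
    T₂₂≤ bound = bound (filter (counted? j N) quadruples) (Unique.filter⁺ (counted? j N) quadruples-unique)
      (All.tabulate λ {x} x∈ → counted⇒parallelogram {x} (proj₂ (∈-filter⁻ (counted? j N) {xs = quadruples} x∈)))

    atMost-parallelogram : AtMost (4N ℕ.* (4N ℕ.* B) ℕ.+ (4N ℕ.* 4N ℕ.+ (4N ℕ.* (4N ℕ.* 2) ℕ.+ 160 ℕ.* (N ℕ.* N) ℕ.* (D ℕ.* D ℕ.* (D ℕ.* D))))) Parallelogram
    atMost-parallelogram = [ large-case , small-case ]′ (ℕ.<-≤-connex (8 ℕ.* N) q)
      where
      M = 4N ℕ.* (4N ℕ.* B) ℕ.+ (4N ℕ.* 4N ℕ.+ (4N ℕ.* (4N ℕ.* 2) ℕ.+ 160 ℕ.* (N ℕ.* N) ℕ.* (D ℕ.* D ℕ.* (D ℕ.* D))))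
      small-case : q ℕ.≤ 8 ℕ.* N → AtMost M Parallelogram
      small-case q≤8N xs u ps = ℕ.≤-trans (atMost-small xs u (All.map (λ { (h , b , b′ , p , p′ , refl , h≡) → small-coded p p′ h≡ (small-q q≤8N h) }) ps))
        (ℕ.m≤m+n _ _)
      large-case : 8 ℕ.* N ℕ.< q → AtMost M Parallelogram
      large-case 8N<q = atMost-⊆
        (λ { (h , b , b′ , p , p′ , refl , h≡) → parallelogram-coded 8N<q p p′ h≡ (length (UU h) ℕ.≤? B) (h Fin.≟ ⟦ 0 ⟧) })
        (atMost-∪ atMost-small (atMost-∪ atMost-zero (atMost-∪ (atMost-equal 8N<q) (atMost-structured 8N<q))))

    -- The degenerate contributions 16N² (h = 0) and 32N² (k′ = ± k) are absorbed by D⁴ ≥ 1: 160 +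
    -- 48 = 208.
    energy-bound : T₂₂ j N ℕ.≤ N ℕ.* N ℕ.* (16 ℕ.* B ℕ.+ 208 ℕ.* (D ℕ.* D ℕ.* (D ℕ.* D)))
    energy-bound = ℕ.≤-trans (T₂₂≤ atMost-parallelogram) (begin
      4 ℕ.* N ℕ.* (4 ℕ.* N ℕ.* B) ℕ.+ (4 ℕ.* N ℕ.* (4 ℕ.* N) ℕ.+ (4 ℕ.* N ℕ.* (4 ℕ.* N ℕ.* 2) ℕ.+ 160 ℕ.* (N ℕ.* N) ℕ.* D⁴)) ≡⟨ id₁ N B D⁴ ⟩
      N ℕ.* N ℕ.* (16 ℕ.* B ℕ.+ 160 ℕ.* D⁴) ℕ.+ N ℕ.* N ℕ.* 48 ℕ.* 1 ≤⟨ ℕ.+-monoʳ-≤ (N ℕ.* N ℕ.* (16 ℕ.* B ℕ.+ 160 ℕ.* D⁴)) (ℕ.*-monoʳ-≤ (N ℕ.* N ℕ.* 48) 1≤D⁴) ⟩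
      N ℕ.* N ℕ.* (16 ℕ.* B ℕ.+ 160 ℕ.* D⁴) ℕ.+ N ℕ.* N ℕ.* 48 ℕ.* D⁴ ≡⟨ id₂ (N ℕ.* N) B D⁴ ⟩
      N ℕ.* N ℕ.* (16 ℕ.* B ℕ.+ 208 ℕ.* D⁴) ∎)
      where
      open ℕ.≤-Reasoning
      D⁴ = D ℕ.* D ℕ.* (D ℕ.* D)
      1≤D⁴ : 1 ℕ.≤ D⁴
      1≤D⁴ = ℕ.*-mono-≤ (ℕ.*-mono-≤ 1≤D 1≤D) (ℕ.*-mono-≤ 1≤D 1≤D)
      id₁ : ∀ N B E → 4 ℕ.* N ℕ.* (4 ℕ.* N ℕ.* B) ℕ.+ (4 ℕ.* N ℕ.* (4 ℕ.* N) ℕ.+ (4 ℕ.* N ℕ.* (4 ℕ.* N ℕ.* 2) ℕ.+ 160 ℕ.* (N ℕ.* N) ℕ.* E))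
            ≡ N ℕ.* N ℕ.* (16 ℕ.* B ℕ.+ 160 ℕ.* E) ℕ.+ N ℕ.* N ℕ.* 48 ℕ.* 1
      id₁ = solve-∀ℕ
      id₂ : ∀ n B E → n ℕ.* (16 ℕ.* B ℕ.+ 160 ℕ.* E) ℕ.+ n ℕ.* 48 ℕ.* E ≡ n ℕ.* (16 ℕ.* B ℕ.+ 208 ℕ.* E)
      id₂ = solve-∀ℕ

-- From integer inequalities to the cuts of the real powers

module Rationals where

  open import Data.Integer.Base as ℤ using (+_; ∣_∣)
  import Data.Integer.Properties as ℤ
  open import Data.Rational.Unnormalised.Base as ℚᵘ using (ℚᵘ; mkℚᵘ; Positive; NonNegative; _/_; _+_; _*_; _÷_; 1/_; _≤_; _<_; _≃_; *≤*; *≡*; 1ℚᵘ; ↥_; ↧ₙ_; +-*-rawSemiring)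
  open import Data.Rational.Unnormalised.Properties
  open import Data.Rational.Unnormalised.Solver using (module +-*-Solver)
  open import Algebra.Definitions.RawSemiring +-*-rawSemiring using (_^_)

  fromℕ-mono : ∀ {m n} → m ℕ.≤ n → fromℕ m ≤ fromℕ n
  fromℕ-mono {m} {n} m≤n = *≤* (ℤ.*-monoʳ-≤-nonNeg (+ 1) (ℤ.+≤+ m≤n))

  fromℕ-pos : ∀ n .{{_ : NonZero n}} → Positive (fromℕ n)
  fromℕ-pos (suc n) = _

  ÷≡*1/ : ∀ p q .{{_ : ℚᵘ.NonZero q}} → p ÷ q ≡ p * (1/ q)
  ÷≡*1/ (mkℚᵘ _ _) (mkℚᵘ _ _) = refl

  fromℕ-+ : ∀ m n → fromℕ (m ℕ.+ n) ≃ fromℕ m + fromℕ n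
  fromℕ-+ m n = *≡* (cong (ℤ._* + 1) (trans (ℤ.pos-+ m n) (sym (cong₂ ℤ._+_ (ℤ.*-identityʳ (+ m)) (ℤ.*-identityʳ (+ n))))))

  fromℕ-* : ∀ m n → fromℕ (m ℕ.* n) ≃ fromℕ m * fromℕ n
  fromℕ-* m n = *≡* (cong (ℤ._* + 1) (ℤ.pos-* m n))

  fromℕ-^ : ∀ m n → fromℕ (m ℕ.^ n) ≃ fromℕ m ^ n
  fromℕ-^ m zero = ≃-refl
  fromℕ-^ m (suc n) = ≃-trans (fromℕ-* m (m ℕ.^ n)) (*-congˡ {fromℕ m} (fromℕ-^ m n))

  ^-nonNeg : ∀ x n .{{_ : NonNegative x}} → NonNegative (x ^ n)
  ^-nonNeg x zero = _
  ^-nonNeg x (suc n) = nonNeg*nonNeg⇒nonNeg x (x ^ n) {{^-nonNeg x n}}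

  ^-mono-< : ∀ {x y} n .{{_ : NonNegative x}} → x < y → x ^ suc n < y ^ suc n
  ^-mono-< {x} {y} zero x<y = *-monoˡ-<-pos 1ℚᵘ x<y
  ^-mono-< {x} {y} (suc n) {{x≥0}} x<y = *-mono-<-nonNeg {x} {y} {x ^ suc n} {y ^ suc n} {{x≥0}} {{^-nonNeg x (suc n)}} x<y (^-mono-< n x<y)

  ^-cancel-≤ : ∀ {x y} n .{{_ : NonZero n}} .{{_ : NonNegative y}} → x ^ n ≤ y ^ n → x ≤ y
  ^-cancel-≤ (suc n) x^n≤y^n = ≮⇒≥ λ y<x → <⇒≱ (^-mono-< n y<x) x^n≤y^n

  ^-*-distribᵘ : ∀ x y n → (x * y) ^ n ≃ x ^ n * y ^ n
  ^-*-distribᵘ x y zero = ≃-sym (*-identityˡ 1ℚᵘ)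
  ^-*-distribᵘ x y (suc n) = ≃-trans (*-congˡ {x * y} (^-*-distribᵘ x y n))
    (solve 4 (λ x y a b → (x :* y) :* (a :* b) := (x :* a) :* (y :* b)) ≃-refl x y (x ^ n) (y ^ n))
    where open +-*-Solver

  module Quotient (N q : ℕ) .{{_ : NonZero q}} (u v : ℚᵘ) .{{v>0 : Positive v}}
                  (u≥ : [ N ^ + 3 / 2 ]≤ u) (v≤ : v ≤[ q ^ + 1 / 2 ]) where

    open ≤-Reasoning
    open +-*-Solver using (solve; _:*_; _:+_; _:=_; con)

    private
      instance
        v≢0 : ℚᵘ.NonZero v
        v≢0 = pos⇒nonZero v
        u≥0 : NonNegative u
        u≥0 = proj₁ u≥
        v≥0 : NonNegative v
        v≥0 = pos⇒nonNeg v
        1/v≥0 : NonNegative (1/ v)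
        1/v≥0 = pos⇒nonNeg (1/ v) {{1/pos⇒pos v}}
        q>0 : Positive (fromℕ q)
        q>0 = fromℕ-pos q

    ρ σ : ℚᵘ
    ρ = u * (1/ v)
    σ = ρ + 1ℚᵘ

    instance
      ρ≥0 : NonNegative ρ
      ρ≥0 = nonNeg*nonNeg⇒nonNeg u (1/ v)
      σ≥0 : NonNegative σ
      σ≥0 = nonNeg+nonNeg⇒nonNeg ρ 1ℚᵘ

    1≤σ : 1ℚᵘ ≤ σ
    1≤σ = p≤q⇒p≤r+q ρ ≤-refl

    ρ*v≃u : ρ * v ≃ u
    ρ*v≃u = ≃-trans (*-assoc u (1/ v) v) (≃-trans (*-congˡ {u} (*-inverseˡ v)) (*-identityʳ u))

    -- N³ ≤ u² = ρ² v² ≤ ρ² q, the outer steps being the cut conditions on u and v.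
    N³≤ρ²q : fromℕ (N ℕ.* N ℕ.* N) ≤ ρ * ρ * fromℕ q
    N³≤ρ²q = begin
      fromℕ (N ℕ.* N ℕ.* N)    ≡⟨ cong fromℕ (trans (ℕ.*-assoc N N N) (cong (λ z → N ℕ.* (N ℕ.* z)) (sym (ℕ.*-identityʳ N)))) ⟩
      fromℕ (N ℕ.^ 3)          ≃⟨ fromℕ-^ N 3 ⟩
      fromℕ N ^ 3              ≤⟨ proj₂ u≥ ⟩
      u * (u * 1ℚᵘ)            ≃⟨ *-congˡ {u} (*-identityʳ u) ⟩
      u * u                    ≃⟨ *-cong ρ*v≃u ρ*v≃u ⟨
      (ρ * v) * (ρ * v)        ≃⟨ solve 2 (λ r v → (r :* v) :* (r :* v) := (r :* r) :* (v :* v)) ≃-refl ρ v ⟩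
      (ρ * ρ) * (v * v)        ≃⟨ *-congˡ {ρ * ρ} (*-congˡ {v} (*-identityʳ v)) ⟨
      (ρ * ρ) * (v * (v * 1ℚᵘ)) ≤⟨ *-monoʳ-≤-nonNeg (ρ * ρ) {{nonNeg*nonNeg⇒nonNeg ρ ρ}} (proj₂ v≤) ⟩
      (ρ * ρ) * (fromℕ q * 1ℚᵘ) ≃⟨ *-congˡ {ρ * ρ} (*-identityʳ (fromℕ q)) ⟩
      ρ * ρ * fromℕ q          ∎

    ρ²+1≤σ² : ρ * ρ + 1ℚᵘ ≤ σ * σ
    ρ²+1≤σ² = begin
      ρ * ρ + 1ℚᵘ              ≤⟨ p≤q⇒p≤r+q (ρ + ρ) {{nonNeg+nonNeg⇒nonNeg ρ ρ}} ≤-refl ⟩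
      (ρ + ρ) + (ρ * ρ + 1ℚᵘ)  ≃⟨ solve 1 (λ r → (r :+ r) :+ (r :* r :+ con 1ℤ) := (r :+ con 1ℤ) :* (r :+ con 1ℤ)) ≃-refl ρ ⟩
      σ * σ                    ∎
      where 1ℤ = 1ℚᵘ

    -- B² q ≤ c² (ρ² q + q) ≤ (c σ)² q; then q and the squares are cancelled. It is applied with c =
    -- 17 D.
    B≤ : ∀ {B c} → B ℕ.* B ℕ.* q ℕ.≤ c ℕ.* c ℕ.* (N ℕ.* N ℕ.* N ℕ.+ q) → fromℕ B ≤ fromℕ c * σ
    B≤ {B} {c} B²q≤ = ^-cancel-≤ 2 {{_}} {{nonNeg*nonNeg⇒nonNeg (fromℕ c) σ}} (*-cancelʳ-≤-pos (fromℕ q) (begin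
      fromℕ B * (fromℕ B * 1ℚᵘ) * fromℕ q      ≃⟨ *-congʳ {fromℕ q} (*-congˡ {fromℕ B} (*-identityʳ (fromℕ B))) ⟩
      fromℕ B * fromℕ B * fromℕ q              ≃⟨ *-congʳ {fromℕ q} (fromℕ-* B B) ⟨
      fromℕ (B ℕ.* B) * fromℕ q                ≃⟨ fromℕ-* (B ℕ.* B) q ⟨
      fromℕ (B ℕ.* B ℕ.* q)                    ≤⟨ fromℕ-mono B²q≤ ⟩
      fromℕ (c ℕ.* c ℕ.* (N³ ℕ.+ q))           ≃⟨ ≃-trans (fromℕ-* (c ℕ.* c) (N³ ℕ.+ q)) (*-cong (fromℕ-* c c) (fromℕ-+ N³ q)) ⟩
      fromℕ c * fromℕ c * (fromℕ N³ + fromℕ q) ≤⟨ *-monoʳ-≤-nonNeg (fromℕ c * fromℕ c) {{nonNeg*nonNeg⇒nonNeg (fromℕ c) (fromℕ c)}} (+-monoˡ-≤ (fromℕ q) N³≤ρ²q) ⟩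
      fromℕ c * fromℕ c * (ρ * ρ * fromℕ q + fromℕ q) ≃⟨ solve 3 (λ c r q → c :* c :* (r :* r :* q :+ q) := c :* c :* q :* (r :* r :+ con 1ℚᵘ)) ≃-refl (fromℕ c) ρ (fromℕ q) ⟩
      fromℕ c * fromℕ c * fromℕ q * (ρ * ρ + 1ℚᵘ) ≤⟨ *-monoʳ-≤-nonNeg (fromℕ c * fromℕ c * fromℕ q) {{nonNeg*nonNeg⇒nonNeg (fromℕ c * fromℕ c) {{nonNeg*nonNeg⇒nonNeg (fromℕ c) (fromℕ c)}} (fromℕ q)}} ρ²+1≤σ² ⟩
      fromℕ c * fromℕ c * fromℕ q * (σ * σ)    ≃⟨ solve 3 (λ c s q → c :* c :* q :* (s :* s) := (c :* s) :* ((c :* s) :* con 1ℚᵘ) :* q) ≃-refl (fromℕ c) σ (fromℕ q) ⟩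
      (fromℕ c * σ) * ((fromℕ c * σ) * 1ℚᵘ) * fromℕ q ∎))
      where N³ = N ℕ.* N ℕ.* N

  numerator-2+ε : ∀ a b → ∣ ↥ ((+ 2 / 1) + mkℚᵘ (+ suc a) b) ∣ ≡ 2 ℕ.* suc b ℕ.+ suc a
  numerator-2+ε a b = cong (2 ℕ.* suc b ℕ.+_) (ℕ.*-identityʳ (suc a))

  denominator-2+ε : ∀ a b → ↧ₙ ((+ 2 / 1) + mkℚᵘ (+ suc a) b) ≡ suc b
  denominator-2+ε a b = cong suc (ℕ.+-identityʳ b)

  -- Compared after raising to the power b + 1, the denominator of 2 + ε: there the cut condition on
  -- w speaks of the same integer power of N as the divisor bound.
  N²D⁴≤C*w : ∀ {a b N X C w} → X ℕ.^ suc b ℕ.≤ C ℕ.^ suc b ℕ.* N ℕ.^ (2 ℕ.* suc b ℕ.+ suc a) →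
             [ N ^ (+ 2 / 1) + mkℚᵘ (+ suc a) b ]≤ w → fromℕ X ≤ fromℕ C * w
  N²D⁴≤C*w {a} {b} {N} {X} {C} {w} X^b≤ (w≥0 , N^≤w^) = ^-cancel-≤ (suc b) {{_}} {{nonNeg*nonNeg⇒nonNeg (fromℕ C) w {{w≥0}}}} (begin
    fromℕ X ^ suc b                    ≃⟨ fromℕ-^ X (suc b) ⟨
    fromℕ (X ℕ.^ suc b)                ≤⟨ fromℕ-mono X^b≤ ⟩
    fromℕ (C ℕ.^ suc b ℕ.* N ℕ.^ A)    ≃⟨ ≃-trans (fromℕ-* (C ℕ.^ suc b) (N ℕ.^ A)) (*-cong (fromℕ-^ C (suc b)) (fromℕ-^ N A)) ⟩
    fromℕ C ^ suc b * fromℕ N ^ A      ≤⟨ *-monoʳ-≤-nonNeg (fromℕ C ^ suc b) {{^-nonNeg (fromℕ C) (suc b)}}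
                                            (subst₂ (λ m n → fromℕ N ^ m ≤ w ^ n) (numerator-2+ε a b) (denominator-2+ε a b) N^≤w^) ⟩
    fromℕ C ^ suc b * w ^ suc b        ≃⟨ ^-*-distribᵘ (fromℕ C) w (suc b) ⟨
    (fromℕ C * w) ^ suc b              ∎)
    where
    open ≤-Reasoning
    A = 2 ℕ.* suc b ℕ.+ suc a

  -- Used with n = N² and E = D⁴. The term 208 E is multiplied by σ ≥ 1 so that σ factors out, and
  -- 16 · 17 D ≤ 272 E gives 272 + 208 = 480.
  combine-bounds : ∀ {T n E D B C σ w} → 1ℚᵘ ≤ σ → .{{_ : NonNegative σ}} → D ℕ.≤ E →
    T ℕ.≤ n ℕ.* (16 ℕ.* B ℕ.+ 208 ℕ.* E) → fromℕ B ≤ fromℕ (17 ℕ.* D) * σ → fromℕ (n ℕ.* E) ≤ fromℕ C * w →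
    fromℕ T ≤ fromℕ (480 ℕ.* C) * σ * w
  combine-bounds {T} {n} {E} {D} {B} {C} {σ} {w} 1≤σ D≤E T≤ B≤ nE≤ = begin
    fromℕ T                                                  ≤⟨ fromℕ-mono T≤ ⟩
    fromℕ (n ℕ.* (16 ℕ.* B ℕ.+ 208 ℕ.* E))                   ≃⟨ ≃-trans (fromℕ-* n _) (*-congˡ {fromℕ n} (≃-trans (fromℕ-+ (16 ℕ.* B) (208 ℕ.* E)) (+-cong (fromℕ-* 16 B) (≃-sym (*-identityʳ (fromℕ (208 ℕ.* E))))))) ⟩
    fromℕ n * (fromℕ 16 * fromℕ B + fromℕ (208 ℕ.* E) * 1ℚᵘ) ≤⟨ *-monoʳ-≤-nonNeg (fromℕ n) (+-mono-≤ (*-monoʳ-≤-nonNeg (fromℕ 16) B≤) (*-monoʳ-≤-nonNeg (fromℕ (208 ℕ.* E)) 1≤σ)) ⟩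
    fromℕ n * (fromℕ 16 * (fromℕ (17 ℕ.* D) * σ) + fromℕ (208 ℕ.* E) * σ) ≃⟨ solve 5 (λ n x y z s → n :* (x :* (y :* s) :+ z :* s) := n :* (x :* y :+ z) :* s) ≃-refl (fromℕ n) (fromℕ 16) (fromℕ (17 ℕ.* D)) (fromℕ (208 ℕ.* E)) σ ⟩
    fromℕ n * (fromℕ 16 * fromℕ (17 ℕ.* D) + fromℕ (208 ℕ.* E)) * σ ≃⟨ *-congʳ {σ} (≃-trans (fromℕ-* n _) (*-congˡ {fromℕ n} (≃-trans (fromℕ-+ (16 ℕ.* (17 ℕ.* D)) (208 ℕ.* E)) (+-congˡ (fromℕ (208 ℕ.* E)) (fromℕ-* 16 (17 ℕ.* D)))))) ⟨
    fromℕ (n ℕ.* (16 ℕ.* (17 ℕ.* D) ℕ.+ 208 ℕ.* E)) * σ      ≤⟨ *-monoˡ-≤-nonNeg σ (fromℕ-mono coefficient≤) ⟩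
    fromℕ (480 ℕ.* (n ℕ.* E)) * σ                            ≃⟨ *-congʳ {σ} (fromℕ-* 480 (n ℕ.* E)) ⟩
    fromℕ 480 * fromℕ (n ℕ.* E) * σ                          ≤⟨ *-monoˡ-≤-nonNeg σ (*-monoʳ-≤-nonNeg (fromℕ 480) nE≤) ⟩
    fromℕ 480 * (fromℕ C * w) * σ                            ≃⟨ solve 4 (λ x c w s → x :* (c :* w) :* s := x :* c :* s :* w) ≃-refl (fromℕ 480) (fromℕ C) w σ ⟩
    fromℕ 480 * fromℕ C * σ * w                              ≃⟨ *-congʳ {w} (*-congʳ {σ} (fromℕ-* 480 C)) ⟨
    fromℕ (480 ℕ.* C) * σ * w                                ∎
    where
    open ≤-Reasoning
    open +-*-Solver
    coefficient≤ : n ℕ.* (16 ℕ.* (17 ℕ.* D) ℕ.+ 208 ℕ.* E) ℕ.≤ 480 ℕ.* (n ℕ.* E)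
    coefficient≤ = ℕ.≤-trans (ℕ.*-monoʳ-≤ n (ℕ.+-monoˡ-≤ (208 ℕ.* E) (ℕ.*-monoʳ-≤ 16 (ℕ.*-monoʳ-≤ 17 D≤E)))) (ℕ.≤-reflexive (identity n E))
      where
      identity : ∀ n E → n ℕ.* (16 ℕ.* (17 ℕ.* E) ℕ.+ 208 ℕ.* E) ≡ 480 ℕ.* (n ℕ.* E)
      identity = solve-∀ℕ

open import Data.Integer.Base using (+_)
open import Data.Rational.Unnormalised.Base using (ℚᵘ; mkℚᵘ; Positive; _/_; _+_; _*_; _÷_; _≤_; 1ℚᵘ)
open import Data.Rational.Unnormalised.Properties using (pos⇒nonZero)
open Divisors
open Energies
open Rationals

theorem1p1 : ∀ (ε : ℚᵘ) → Positive ε →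
    ∃[ C ] Positive C ×
    (∀ (q : ℕ) .{{_ : ℕ.NonZero q}} → Prime q →
    let open Residues q in
    ∀ (j : 𝔽) → j ≢ ⟦ 0 ⟧ →
    ∀ (N : ℕ) → 1 ℕ.≤ N → N ℕ.≤ q →
    ∀ (u v w : ℚᵘ) .{{v>0 : Positive v}} →
    [ N ^ + 3 / 2 ]≤ u →
    v ≤[ q ^ + 1 / 2 ] →
    [ N ^ (+ 2 / 1) + ε ]≤ w →
    fromℕ (T₂₂ j N) ≤ C * ((u ÷ v) {{pos⇒nonZero v}} + 1ℚᵘ) * w)
theorem1p1 (mkℚᵘ (+ 0) _) ()
theorem1p1 (mkℚᵘ (+ suc a) b) _ =
  let C , C≢0 , choose = divisor-constant (suc b) in
  fromℕ (480 ℕ.* C) , fromℕ-pos (480 ℕ.* C) {{ℕ.m*n≢0 480 C {{_}} {{C≢0}}}} ,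
  λ q pq j j≢0 N 1≤N _ u v w u≥ v≤ w≥ →
  let instance N≢0 = ℕ.>-nonZero 1≤N
      D , τ≤D , X^b≤ = choose N
      N²D⁴ = N ℕ.* N ℕ.* (D ℕ.* D ℕ.* (D ℕ.* D))
      c² = cong (ℕ._* (N ℕ.* N ℕ.* N ℕ.+ q)) (17² D)
      -- Maximality of B serves the counting, where small fibres have r ≤ B; the inequality for B
      -- itself serves the comparison with u / v.
      B , B²q≤ , max = largest-square q (289 ℕ.* (D ℕ.* D) ℕ.* (N ℕ.* N ℕ.* N ℕ.+ q))
      module Q = Quadruples q pq j j≢0 N D τ≤D B max
      module R = Quotient N q u v u≥ v≤
  in subst (λ ρ → fromℕ (Residues.T₂₂ q j N) ≤ fromℕ (480 ℕ.* C) * (ρ + 1ℚᵘ) * w) (sym (÷≡*1/ u v {{pos⇒nonZero v}}))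
       (combine-bounds {n = N ℕ.* N} {E = D ℕ.* D ℕ.* (D ℕ.* D)} {D = D} {B = B} {C = C} R.1≤σ (D≤D⁴ D Q.1≤D) Q.energy-bound (R.B≤ (subst (B ℕ.* B ℕ.* q ℕ.≤_) c² B²q≤)) (N²D⁴≤C*w {a} {b} {N} {N²D⁴} {C} {w} (X^b≤ a) w≥))
  where
  17² : ∀ D → 289 ℕ.* (D ℕ.* D) ≡ 17 ℕ.* D ℕ.* (17 ℕ.* D)
  17² = solve-∀ℕ
  D≤D⁴ : ∀ D → 1 ℕ.≤ D → D ℕ.≤ D ℕ.* D ℕ.* (D ℕ.* D)
  D≤D⁴ D 1≤D = ℕ.≤-trans (ℕ.m≤m*n D D) (ℕ.m≤m*n (D ℕ.* D) (D ℕ.* D) {{ℕ.m*n≢0 D D}})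
    where instance _ = ℕ.>-nonZero 1≤D
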